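{- Let $(X,d)$ be a compact metric space, let $(x_i)_{i\ge1}$ and $(x'_i)_{i\ge1}$ be two sequences in $X$, and fix a fast growing sequence $(p_i)_{i\ge0}$. Let $z=z((p_i),(x_i))$ and $z'=z((p_i),(x'_i))$ be the associated Oxtoby sequences, and assume that $z$ and $z'$ are non-periodic. Then the following are equivalent: (1) the Oxtoby systems $(\overline O(z),S)$ and $(\overline O(z'),S)$ are conjugate; (2) $(x_i)$ and $(x'_i)$ have the same topological type.
   Context: $S$ is the left shift on $X^{\mathbb Z}$, $S(x)(n)=x(n+1)$, and $\overline O(z)$ is the closure of $\{S^nz:n\in\mathbb Z\}$ in $X^{\mathbb Z}$. A sequence $z\in X^{\mathbb Z}$ is non-periodic if $S^nz\ne z$ for all $n\neq 0$. Systems $(A,S)$, $(B,S)$ are conjugate if there is a homeomorphism $h:A\to B$ with $h\circ S=S\circ h$. Two sequences $(x_n)$, $(x_n')$ have the same topological type if for every increasing sequence of natural numbers $(n_k)$, $(x_{n_k})$ converges iff $(x'_{n_k})$ converges. A sequence of natural numbers $(p_i)_{i\ge0}$ is fast growing if $p_0=1$, $p_i\mid p_{i+1}$ and $p_{i+1}/p_i\ge 3$ for all $i\ge0$. Given a fast growing sequence $(p_i)$ and a sequence $(x_i)_{i\ge1}$ in $X$, the Oxtoby sequence $z=z((p_i),(x_i))\in X^{\mathbb Z}$ is defined inductively: in step $1$ set $z(n)=x_1$ for all $n\equiv-1$ or $0\pmod{p_1}$. For $i\ge1$ and $k\in\mathbb Z$ let $J(i,k)$ be the set of $n\in[kp_i,(k+1)p_i)$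 for which $z(n)$ is not yet defined at the end of step $i$; in step $i+1$ set $z(n)=x_{i+1}$ for all $n\in J(i,k)$ with $k\equiv-1$ or $0\pmod{p_{i+1}/p_i}$. This defines $z(n)$ for all $n\in\mathbb Z$. The Oxtoby system is $(\overline O(z),S)$. -}

module Defs where

open import Level using (Level; _⊔_; 0ℓ) renaming (suc to lsuc)
open import Data.Nat.Base as ℕ using (ℕ; zero; suc; NonZero)
import Data.Nat.Properties as ℕ
import Data.Nat.DivMod as ℕ
open import Data.Nat.Divisibility using (_∣_; quotient; _∣?_; _∣0; m∣n⇒n≡quotient*m)
open import Data.Integer.Base as ℤ using (ℤ; +_; -[1+_]; 0ℤ; 1ℤ; -1ℤ; _/ℕ_)
import Data.Integer.Properties as ℤ
open import Data.Rational.Base as ℚ using (ℚ; 0ℚ; 1ℚ; ½)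
import Data.Rational.Properties as ℚ
open import Algebra.Bundles using (CommutativeMonoid)
import Algebra.Properties.CommutativeSemigroup as CommutativeSemigroup
open import Data.List.Base using (List)
import Data.List.Base as List
open import Data.List.Relation.Unary.All as All using (All)
open import Data.List.Relation.Unary.All.Properties using (map⁻)
open import Data.List.Relation.Unary.Any using (Any)
open import Data.Maybe.Base using (Maybe; just; nothing; _<∣>_)
open import Data.Product.Base using (Σ; Σ-syntax; ∃; ∃₂; _×_; _,_; proj₁; proj₂)
open import Data.Sum.Base using (_⊎_; inj₁; inj₂)
open import Data.Bool.Base using (if_then_else_)
open import Function.Base using (_∘_)
open import Function.Bundles using (Inverse; _⇔_)
open import Function.Metric.Structures using (IsGeneralMetric)
open import Relation.Binary.Bundles using (Setoid)
open import Relation.Binary.Structures using (IsPartialOrder; IsEquivalence)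
import Relation.Binary.Construct.On as On
open import Relation.Binary.PropositionalEquality
open import Relation.Nullary using (¬_; Dec; yes; no; does)
open import Relation.Nullary.Decidable using (_⊎-dec_; dec-true)
open import Relation.Unary using (Pred; _∈_)

------------------------------------------------------------------------
-- Real numbers, as Cauchy sequences of rationals

Cauchy : (ℕ → ℚ) → Set
Cauchy s = ∀ ε → 0ℚ ℚ.< ε →
  ∃ λ N → ∀ m n → N ℕ.≤ m → N ℕ.≤ n → ℚ.∣ s m ℚ.- s n ∣ ℚ.< ε

record ℝ : Set where
  constructor mkℝ
  field
    seq    : ℕ → ℚ
    cauchy : Cauchy seq

open ℝ public

private
  half-pos : ∀ {ε} → 0ℚ ℚ.< ε → 0ℚ ℚ.< ½ ℚ.* ε
  half-pos {ε} 0<ε = subst (ℚ._< ½ ℚ.* ε) (ℚ.*-zeroʳ ½) (ℚ.*-monoʳ-<-pos ½ 0<ε)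

  halves : ∀ ε → ½ ℚ.* ε ℚ.+ ½ ℚ.* ε ≡ ε
  halves ε = trans (sym (ℚ.*-distribʳ-+ ε ½ ½)) (ℚ.*-identityˡ ε)

  interchange : ∀ a b c e → (a ℚ.+ b) ℚ.- (c ℚ.+ e) ≡ (a ℚ.- c) ℚ.+ (b ℚ.- e)
  interchange a b c e = trans (cong ((a ℚ.+ b) ℚ.+_) (ℚ.neg-distrib-+ c e))
    (CommutativeSemigroup.interchange
      (CommutativeMonoid.commutativeSemigroup ℚ.+-0-commutativeMonoid) a b (ℚ.- c) (ℚ.- e))

0ℝ : ℝ
0ℝ = mkℝ (λ _ → 0ℚ) (λ ε 0<ε → 0 , λ _ _ _ _ → 0<ε)

infixl 6 _+ℝ_
infix  4 _≤ℝ_ _≈ℝ_ _<ℝ_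

_+ℝ_ : ℝ → ℝ → ℝ
x +ℝ y = mkℝ (λ n → seq x n ℚ.+ seq y n) λ ε 0<ε →
  let (M , hM) = cauchy x (½ ℚ.* ε) (half-pos 0<ε)
      (N , hN) = cauchy y (½ ℚ.* ε) (half-pos 0<ε)
  in M ℕ.⊔ N , λ m n ≤m ≤n →
     subst (λ t → ℚ.∣ t ∣ ℚ.< ε) (sym (interchange (seq x m) (seq y m) (seq x n) (seq y n)))
       (subst (ℚ.∣ (seq x m ℚ.- seq x n) ℚ.+ (seq y m ℚ.- seq y n) ∣ ℚ.<_) (halves ε)
         (ℚ.≤-<-trans (ℚ.∣p+q∣≤∣p∣+∣q∣ (seq x m ℚ.- seq x n) (seq y m ℚ.- seq y n))
           (ℚ.+-mono-<
             (hM m n (ℕ.≤-trans (ℕ.m≤m⊔n M N) ≤m) (ℕ.≤-trans (ℕ.m≤m⊔n M N) ≤n))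
             (hN m n (ℕ.≤-trans (ℕ.m≤n⊔m M N) ≤m) (ℕ.≤-trans (ℕ.m≤n⊔m M N) ≤n)))))

_≤ℝ_ : ℝ → ℝ → Set
x ≤ℝ y = ∀ ε → 0ℚ ℚ.< ε → ∃ λ N → ∀ n → N ℕ.≤ n → seq x n ℚ.≤ seq y n ℚ.+ ε

_≈ℝ_ : ℝ → ℝ → Set
x ≈ℝ y = x ≤ℝ y × y ≤ℝ x

_<ℝ_ : ℝ → ℝ → Set
x <ℝ y = ∃ λ ε → 0ℚ ℚ.< ε × ∃ λ N → ∀ n → N ℕ.≤ n → seq x n ℚ.+ ε ℚ.≤ seq y n

≤ℝ-refl : ∀ {x} → x ≤ℝ x
≤ℝ-refl {x} ε 0<ε = 0 , λ n _ →
  subst (ℚ._≤ seq x n ℚ.+ ε) (ℚ.+-identityʳ (seq x n)) (ℚ.+-monoʳ-≤ (seq x n) (ℚ.<⇒≤ 0<ε))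

≤ℝ-trans : ∀ {x y z} → x ≤ℝ y → y ≤ℝ z → x ≤ℝ z
≤ℝ-trans {x} {y} {z} x≤y y≤z ε 0<ε =
  let (M , hM) = x≤y (½ ℚ.* ε) (half-pos 0<ε)
      (N , hN) = y≤z (½ ℚ.* ε) (half-pos 0<ε)
  in M ℕ.⊔ N , λ n ≤n →
     subst (seq x n ℚ.≤_)
       (trans (ℚ.+-assoc (seq z n) (½ ℚ.* ε) (½ ℚ.* ε)) (cong (seq z n ℚ.+_) (halves ε)))
       (ℚ.≤-trans (hM n (ℕ.≤-trans (ℕ.m≤m⊔n M N) ≤n))
         (ℚ.+-monoˡ-≤ (½ ℚ.* ε) (hN n (ℕ.≤-trans (ℕ.m≤n⊔m M N) ≤n))))

≤ℝ-isPartialOrder : IsPartialOrder _≈ℝ_ _≤ℝ_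
≤ℝ-isPartialOrder = record
  { isPreorder = record
    { isEquivalence = record
      { refl  = λ {x} → ≤ℝ-refl {x} , ≤ℝ-refl {x}
      ; sym   = λ (p , q) → q , p
      ; trans = λ {x} {y} {z} (p , q) (r , s) →
                  ≤ℝ-trans {x} {y} {z} p r , ≤ℝ-trans {z} {y} {x} s q
      }
    ; reflexive = proj₁
    ; trans     = λ {x} {y} {z} → ≤ℝ-trans {x} {y} {z}
    }
  ; antisym = _,_
  }

------------------------------------------------------------------------
-- Metric spaces.  Points are compared by the setoid equality _≈_, which
-- the metric axioms force to coincide with being at distance 0.

record MetricSpace (a ℓ : Level) : Set (lsuc (a ⊔ ℓ)) where
  infix 4 _≈_
  field
    Carrier  : Set a
    _≈_      : Carrier → Carrier → Set ℓ
    d        : Carrier → Carrier → ℝ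
    isMetric : IsGeneralMetric _≈_ _≈ℝ_ _≤ℝ_ 0ℝ _+ℝ_ d

  open IsGeneralMetric isMetric public using (≈-isEquivalence)

module _ {a ℓ : Level} (X : MetricSpace a ℓ) where
  open MetricSpace X

  IsOpen : ∀ {k} → Pred Carrier k → Set (a ⊔ k)
  IsOpen U = ∀ x → x ∈ U → ∃ λ r → 0ℝ <ℝ r × (∀ y → d x y <ℝ r → y ∈ U)

  IsCompact : Set (lsuc (a ⊔ ℓ))
  IsCompact = (I : Set (a ⊔ ℓ)) (U : I → Pred Carrier (a ⊔ ℓ)) →
    (∀ i → IsOpen (U i)) → (∀ x → ∃ λ i → x ∈ U i) →
    ∃ λ (is : List I) → ∀ x → Any (λ i → x ∈ U i) is

  Converges : (ℕ → Carrier) → Set a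
  Converges x = ∃ λ l → ∀ ε → 0ℝ <ℝ ε → ∃ λ N → ∀ k → N ℕ.≤ k → d (x k) l <ℝ ε

  SameTopologicalType : (x x′ : ℕ → Carrier) → Set a
  SameTopologicalType x x′ =
    (n : ℕ → ℕ) → (∀ {k l} → k ℕ.< l → n k ℕ.< n l) →
    Converges (x ∘ n) ⇔ Converges (x′ ∘ n)

------------------------------------------------------------------------
-- The full shift over X

  Config : Set a
  Config = ℤ → Carrier

  configSetoid : Setoid a ℓ
  configSetoid = record
    { Carrier       = Config
    ; _≈_           = λ u v → ∀ n → u n ≈ v n
    ; isEquivalence = record
      { refl  = λ n → E.refl
      ; sym   = λ p n → E.sym (p n)
      ; trans = λ p q n → E.trans (p n) (q n)
      }
    }
    where module E = IsEquivalence ≈-isEquivalence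

  open Setoid configSetoid using () renaming (_≈_ to _≈ᶜ_)

  S : Config → Config
  S x n = x (n ℤ.+ 1ℤ)

  -- S^ n is the n-th iterate of S, for n of either sign.
  S^ : ℤ → Config → Config
  S^ n x m = x (m ℤ.+ n)

  NonPeriodic : Config → Set ℓ
  NonPeriodic z = ∀ n → n ≢ 0ℤ → ¬ (S^ n z ≈ᶜ z)

  -- For F finite and ε > 0 the sets { v | Near F ε u v } form a
  -- neighbourhood base at u for the product topology.
  Near : List ℤ → ℝ → Config → Config → Set
  Near F ε u v = All (λ n → d (u n) (v n) <ℝ ε) F

  OrbitClosure : Config → Pred Config 0ℓ
  OrbitClosure z w = ∀ F ε → 0ℝ <ℝ ε → ∃ λ n → Near F ε w (S^ n z)

  record Subsystem : Set (lsuc 0ℓ ⊔ a) where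
    field
      Member       : Pred Config 0ℓ
      shift-closed : ∀ {w} → w ∈ Member → S w ∈ Member

    Point : Set a
    Point = Σ[ w ∈ Config ] w ∈ Member

    pointSetoid : Setoid a ℓ
    pointSetoid = On.setoid configSetoid (proj₁ {B = Member})

    shift : Point → Point
    shift (w , w∈) = S w , shift-closed w∈

  -- Continuity for the subspace topologies.
  Continuous : (A B : Subsystem) → (Subsystem.Point A → Subsystem.Point B) → Set a
  Continuous A B f = ∀ u F ε → 0ℝ <ℝ ε → ∃₂ λ G δ → 0ℝ <ℝ δ ×
    (∀ v → Near G δ (proj₁ u) (proj₁ v) → Near F ε (proj₁ (f u)) (proj₁ (f v)))

  record Conjugate (A B : Subsystem) : Set (a ⊔ ℓ) where
    private
      module A = Subsystem A
      module B = Subsystem B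
    field
      bijection : Inverse A.pointSetoid B.pointSetoid
    open Inverse bijection using (to; from)
    field
      to-continuous   : Continuous A B to
      from-continuous : Continuous B A from
      equivariant     : ∀ u → Setoid._≈_ B.pointSetoid (to (A.shift u)) (B.shift (to u))

  OrbitSystem : Config → Subsystem
  OrbitSystem z = record
    { Member       = OrbitClosure z
    ; shift-closed = λ {w} w∈ F ε 0<ε →
        let (n , near) = w∈ (List.map (ℤ._+ 1ℤ) F) ε 0<ε
        in n ℤ.+ 1ℤ , All.map
             (λ {m} → subst (λ t → d (w (m ℤ.+ 1ℤ)) (z t) <ℝ ε) (reassoc m n))
             (map⁻ near)
    }
    where
    reassoc : ∀ m n → (m ℤ.+ 1ℤ) ℤ.+ n ≡ m ℤ.+ (n ℤ.+ 1ℤ)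
    reassoc m n = trans (ℤ.+-assoc m 1ℤ n) (cong (λ t → m ℤ.+ t) (ℤ.+-comm 1ℤ n))

------------------------------------------------------------------------
-- Oxtoby sequences

record FastGrowing (p : ℕ → ℕ) : Set where
  field
    p₀≡1      : p 0 ≡ 1
    p-divides : ∀ i → p i ∣ p (suc i)

  -- ratio i = p (i + 1) / p i
  ratio : ℕ → ℕ
  ratio i = quotient (p-divides i)

  field
    3≤ratio : ∀ i → 3 ℕ.≤ ratio i

  i<pᵢ : ∀ i → i ℕ.< p i
  i<pᵢ zero    = subst (0 ℕ.<_) (sym p₀≡1) (ℕ.s≤s ℕ.z≤n)
  i<pᵢ (suc i) = begin-strict
    suc i           ≤⟨ i<pᵢ i ⟩
    p i             <⟨ ℕ.m<m+n (p i) {p i ℕ.+ 0} (subst (0 ℕ.<_) (sym (ℕ.+-identityʳ (p i))) 0<p) ⟩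
    2 ℕ.* p i       ≤⟨ ℕ.*-monoˡ-≤ (p i) (ℕ.≤-trans (ℕ.n≤1+n 2) (3≤ratio i)) ⟩
    ratio i ℕ.* p i ≡⟨ m∣n⇒n≡quotient*m (p-divides i) ⟨
    p (suc i)       ∎
    where
    open ℕ.≤-Reasoning
    0<p : 0 ℕ.< p i
    0<p = ℕ.≤-<-trans ℕ.z≤n (i<pᵢ i)

  instance
    p-nonZero : ∀ {i} → NonZero (p i)
    p-nonZero {i} = ℕ.>-nonZero (ℕ.≤-<-trans ℕ.z≤n (i<pᵢ i))

module Oxtoby {a : Level} {A : Set a} {p : ℕ → ℕ} (fg : FastGrowing p) (x : ℕ → A) where
  open FastGrowing fg

  -- k ≡ -1 or 0 (mod p (i + 1) / p i)
  Selected : ℕ → ℤ → Set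
  Selected i k = ratio i ∣ ℤ.∣ k ℤ.- -1ℤ ∣ ⊎ ratio i ∣ ℤ.∣ k ∣

  selected? : ∀ i k → Dec (Selected i k)
  selected? i k = (ratio i ∣? ℤ.∣ k ℤ.- -1ℤ ∣) ⊎-dec (ratio i ∣? ℤ.∣ k ∣)

  -- The sequence x is indexed from 0, so step i + 1 uses x i.  Since _/ℕ_
  -- rounds down, n /ℕ p i is the k with n ∈ [k p_i , (k + 1) p_i).
  fill : ℕ → ℤ → Maybe A
  fill i n = if does (selected? i (n /ℕ p i)) then just (x i) else nothing

  -- The part of the sequence defined at the end of step i, with nothing
  -- at the positions not yet defined; values already given take precedence.
  -- As p 0 = 1, the first step needs no separate clause.
  stage : ℕ → ℤ → Maybe A
  stage zero    n = nothing
  stage (suc i) n = stage i n <∣> fill i n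

  private
    <∣>-just : ∀ (u : Maybe A) v → ∃ λ w → (u <∣> just v) ≡ just w
    <∣>-just (just u) v = u , refl
    <∣>-just nothing  v = v , refl

    selected⇒defined : ∀ i n → Selected i (n /ℕ p i) → ∃ λ v → stage (suc i) n ≡ just v
    selected⇒defined i n s
      rewrite dec-true (selected? i (n /ℕ p i)) s = <∣>-just (stage i n) (x i)

    selected-0 : ∀ n → Selected ℤ.∣ n ∣ (n /ℕ p ℤ.∣ n ∣)
    selected-0 (+ m) = inj₂ (subst (ratio m ∣_) (sym (ℕ.m<n⇒m/n≡0 (i<pᵢ m))) (ratio m ∣0))
    selected-0 -[1+ m ]
      rewrite ℕ.m<n⇒m%n≡m {{p-nonZero {suc m}}} (i<pᵢ (suc m))
            | ℕ.m<n⇒m/n≡0 {{p-nonZero {suc m}}} (i<pᵢ (suc m)) = inj₁ (ratio (suc m) ∣0)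

  defined : ∀ n → ∃ λ v → stage (suc ℤ.∣ n ∣) n ≡ just v
  defined n = selected⇒defined ℤ.∣ n ∣ n (selected-0 n)

  z : ℤ → A
  z n = proj₁ (defined n)

  -- z n is the value given to n at whichever step n became defined.
  stage⇒z : ∀ i n {v} → stage i n ≡ just v → z n ≡ v
  stage⇒z i n {v} e = just-inj (trans (sym (extend i (proj₂ (defined n))))
    (trans (cong (λ j → stage j n) (ℕ.+-comm i (suc ℤ.∣ n ∣))) (extend (suc ℤ.∣ n ∣) e)))
    where
    just-inj : ∀ {u w : A} → just u ≡ just w → u ≡ w
    just-inj refl = refl
    extend : ∀ j {i u} → stage i n ≡ just u → stage (j ℕ.+ i) n ≡ just u
    extend zero    h = h
    extend (suc j) {i} h = cong (_<∣> fill (j ℕ.+ i) n) (extend j {i} h)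

{-# OPTIONS --safe #-}

-- Every position n is filled at a definite step i, its level, which depends on (p i) alone, and
-- z n = x i.  Call n an I-hole if it is not filled before step I.  The I-holes are p I-periodic, a
-- multiple of p I is the centre of a gap of the I-holes, these gaps are longer than all others, and
-- the positions congruent to an I-hole mod p I take all the levels i ≥ I.
--
-- Both conditions are compared with "Dominates": for late i and j, x′ i is close to x′ j as soon as
-- x i is close to x j.  By compactness this holds iff x′ ∘ n converges whenever x ∘ n does.
--
-- (2) ⇒ (1).  If z is not periodic, then the position of a long window of z is determined mod p I,
-- because the longest gaps of the I-holes are visible in it.  With domination, close windows of z
-- then have close centres in z′, so Sⁿz ↦ Sⁿz′ extends to the orbit closures.
--
-- (1) ⇒ (2).  Let w be the image of z under a factor map and l the radius of a window of z that
-- determines w up to ε.  Where such windows meet no I-hole of z, w is p I-periodic up to ε, so if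
-- x′ is not Cauchy, then w has no I-hole there.  Hence the central gap of z gives, up to l on either
-- side, a central gap of w, and w is near a shift Sᵠz′ with q ≡ c mod p I and |c| ≤ l, where l does
-- not depend on I.  Comparing windows around two positions where z takes the values x i and x j
-- gives domination.

module Submission where

open import Defs
open import Level using (_⊔_; Lift; lift; lower)
open import Axiom.ExcludedMiddle using (ExcludedMiddle)
open import Data.Empty using (⊥; ⊥-elim)
open import Data.Integer.Base as ℤ
  using (ℤ; +_; -[1+_]; 0ℤ; 1ℤ; -1ℤ; _+_; _*_; -_; _-_; ∣_∣; _/ℕ_; _%ℕ_)
import Data.Integer.DivMod as ℤ
open import Data.Integer.Divisibility.Signed using (divides; ∣ᵤ⇒∣; ∣⇒∣ᵤ; ∣m∣n⇒∣m+n)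
import Data.Integer.Properties as ℤ
open import Data.Integer.Tactic.RingSolver using (solve-∀)
open import Data.List.Base using (List; []; _∷_)
open import Data.List.Relation.Unary.All using (All; []; _∷_)
open import Data.List.Relation.Unary.Any using (Any; here; there)
open import Data.Maybe.Base using (just; nothing)
open import Data.Nat.Base as ℕ using (ℕ; zero; suc; _≤_; _<_; z≤n; s≤s; NonZero)
open import Data.Nat.Coprimality using (1-coprimeTo)
import Data.Nat.Divisibility as ℕ
import Data.Nat.DivMod as ℕ
import Data.Nat.Properties as ℕ
import Data.Nat.Tactic.RingSolver as ℕSolver
open import Data.Product.Base using (∃; ∃₂; _×_; _,_; proj₁; proj₂)
open import Data.Rational.Base as ℚ using (ℚ; 0ℚ; mkℚ; *≤*; *<*)
import Data.Rational.Properties as ℚ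
import Data.Rational.Unnormalised.Base as ℚᵘ
import Data.Rational.Unnormalised.Properties as ℚᵘ
open import Data.Sum.Base as ⊎ using (_⊎_; inj₁; inj₂)
open import Function.Base using (_∘_)
open import Function.Bundles using (Inverse; _⇔_; mk⇔; Equivalence)
open import Function.Metric.Structures using (IsGeneralMetric)
open import Relation.Binary.Definitions using (Tri; tri<; tri≈; tri>)
open import Relation.Binary.PropositionalEquality
open import Relation.Binary.Structures using (IsEquivalence)
open import Relation.Nullary using (¬_; Dec; yes; no)
open import Relation.Nullary.Decidable using (_⊎-dec_; map′; dec-true; dec-false; decidable-stable)
open import Relation.Nullary.Negation using (contradiction)
open import Relation.Unary using (Pred)

-- Dyadic balls

-- mkℚ takes the denominator minus one.
2^_∸1 : ℕ → ℕ
2^ zero  ∸1 = 0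
2^ suc k ∸1 = suc (2^ k ∸1 ℕ.+ 2^ k ∸1)

abstract
  -- The radius 2^-k. It is abstract: below, only halving, positivity, monotonicity and the
  -- archimedean property of these radii are used.
  ρ : ℕ → ℚ
  ρ k = mkℚ ℤ.1ℤ 2^ k ∸1 (1-coprimeTo (suc 2^ k ∸1))

  ρ-halves : ∀ k → ρ (suc k) ℚ.+ ρ (suc k) ≡ ρ k
  ρ-halves k = ℚ.toℚᵘ-injective (ℚᵘ.≃-trans (ℚ.toℚᵘ-homo-+ (ρ (suc k)) (ρ (suc k)))
    (ℚᵘ.*≡* (lemma (ℤ.+ 2^ k ∸1))))
    where
    lemma : ∀ h → (ℤ.1ℤ ℤ.* (ℤ.1ℤ ℤ.+ (ℤ.1ℤ ℤ.+ (h ℤ.+ h))) ℤ.+ ℤ.1ℤ ℤ.* (ℤ.1ℤ ℤ.+ (ℤ.1ℤ ℤ.+ (h ℤ.+ h)))) ℤ.* (ℤ.1ℤ ℤ.+ h)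
                  ≡ ℤ.1ℤ ℤ.* ((ℤ.1ℤ ℤ.+ (ℤ.1ℤ ℤ.+ (h ℤ.+ h))) ℤ.* (ℤ.1ℤ ℤ.+ (ℤ.1ℤ ℤ.+ (h ℤ.+ h))))
    lemma = solve-∀

  0<ρ : ∀ k → 0ℚ ℚ.< ρ k
  0<ρ k = ℚ.positive⁻¹ (ρ k)

  n≤2^n∸1 : ∀ n → n ≤ 2^ n ∸1
  n≤2^n∸1 zero    = ℕ.z≤n
  n≤2^n∸1 (suc n) = ℕ.s≤s (ℕ.≤-trans (n≤2^n∸1 n) (ℕ.m≤m+n _ _))

  -- A positive rational is at least the reciprocal of its denominator `d + 1`, and `d + 1` is at
  -- most 2^d.
  ρ-archimedean : ∀ ε → 0ℚ ℚ.< ε → ∃ λ k → ρ k ℚ.≤ ε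
  ρ-archimedean (mkℚ (ℤ.+ zero) d c) (*<* (ℤ.+<+ ()))
  ρ-archimedean (mkℚ (ℤ.+ suc n) d c) _ = d , *≤* (ℤ.+≤+ le)
    where
    le : suc (d ℕ.+ 0) ≤ suc (2^ d ∸1 ℕ.+ n ℕ.* suc 2^ d ∸1)
    le = ℕ.s≤s (ℕ.≤-trans (ℕ.≤-reflexive (ℕ.+-identityʳ d)) (ℕ.≤-trans (n≤2^n∸1 d) (ℕ.m≤m+n _ _)))

  ρ-decreasing : ∀ k → ρ (suc k) ℚ.≤ ρ k
  ρ-decreasing k = subst₂ ℚ._≤_ (ℚ.+-identityʳ _) (ρ-halves k)
    (ℚ.+-monoʳ-≤ (ρ (suc k)) (ℚ.<⇒≤ (0<ρ (suc k))))

const : ℚ → ℝ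
const q = mkℝ (λ _ → q) λ ε 0<ε → 0 , λ _ _ _ _ →
  subst (λ t → ℚ.∣ t ∣ ℚ.< ε) (sym (ℚ.+-inverseʳ q)) 0<ε

≤-<ℝ-trans : ∀ {x y z} → x ≤ℝ y → y <ℝ z → x <ℝ z
-- The gap `ε` is at least `ρ k`. One half of `ρ k` absorbs the error of `x ≤ℝ y`, the other half is
-- the new gap.
≤-<ℝ-trans {x} {y} {z} x≤y (ε , 0<ε , N , hN) with ρ-archimedean ε 0<ε
... | k , ρ≤ε with x≤y (ρ (suc k)) (0<ρ (suc k))
... | M , hM = ρ (suc k) , 0<ρ (suc k) , M ℕ.⊔ N , λ n ≤n → begin
  seq x n ℚ.+ ρ (suc k)                    ≤⟨ ℚ.+-monoˡ-≤ _ (hM n (ℕ.≤-trans (ℕ.m≤m⊔n M N) ≤n)) ⟩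
  seq y n ℚ.+ ρ (suc k) ℚ.+ ρ (suc k)      ≡⟨ ℚ.+-assoc (seq y n) _ _ ⟩
  seq y n ℚ.+ (ρ (suc k) ℚ.+ ρ (suc k))    ≡⟨ cong (seq y n ℚ.+_) (ρ-halves k) ⟩
  seq y n ℚ.+ ρ k                          ≤⟨ ℚ.+-monoʳ-≤ (seq y n) ρ≤ε ⟩
  seq y n ℚ.+ ε                            ≤⟨ hN n (ℕ.≤-trans (ℕ.m≤n⊔m M N) ≤n) ⟩
  seq z n                                  ∎
  where open ℚ.≤-Reasoning

<const-trans : ∀ {x q y} → x <ℝ const q → (∃ λ N → ∀ n → N ≤ n → q ℚ.≤ seq y n) → x <ℝ y
<const-trans (ε , 0<ε , N , hN) (M , hM) = ε , 0<ε , M ℕ.⊔ N , λ n ≤n →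
  ℚ.≤-trans (hN n (ℕ.≤-trans (ℕ.m≤n⊔m M N) ≤n)) (hM n (ℕ.≤-trans (ℕ.m≤m⊔n M N) ≤n))

p≤p+ε : ∀ p {ε} → 0ℚ ℚ.< ε → p ℚ.≤ p ℚ.+ ε
p≤p+ε p {ε} 0<ε = subst (ℚ._≤ p ℚ.+ ε) (ℚ.+-identityʳ p) (ℚ.+-monoʳ-≤ p (ℚ.<⇒≤ 0<ε))

+-mono-<const : ∀ {x y q r} → x <ℝ const q → y <ℝ const r → x +ℝ y <ℝ const (q ℚ.+ r)
+-mono-<const {x} {y} {q} {r} (ε , 0<ε , N , hN) (δ , 0<δ , M , hM) = δ , 0<δ , M ℕ.⊔ N , λ n ≤n → begin
  seq x n ℚ.+ seq y n ℚ.+ δ    ≡⟨ ℚ.+-assoc (seq x n) _ _ ⟩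
  seq x n ℚ.+ (seq y n ℚ.+ δ)  ≤⟨ ℚ.+-mono-≤ (ℚ.≤-trans (p≤p+ε (seq x n) 0<ε) (hN n (ℕ.≤-trans (ℕ.m≤n⊔m M N) ≤n)))
                                              (hM n (ℕ.≤-trans (ℕ.m≤m⊔n M N) ≤n)) ⟩
  q ℚ.+ r                      ∎
  where open ℚ.≤-Reasoning

0<constρ : ∀ k → 0ℝ <ℝ const (ρ k)
0<constρ k = ρ k , 0<ρ k , 0 , λ _ _ → ℚ.≤-reflexive (ℚ.+-identityˡ (ρ k))

module Uniformity {a ℓ} (X : MetricSpace a ℓ) where
  open MetricSpace X
  private module M = IsGeneralMetric isMetric

  -- A record rather than a synonym, so that k, u and v can be inferred from proofs.
  record E (k : ℕ) (u v : Carrier) : Set where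
    constructor mkE
    field dist : d u v <ℝ const (ρ k)
  open E public

  toE : ∀ k u v → d u v <ℝ const (ρ k) → E k u v
  toE k u v = mkE

  E-reflexive : ∀ {k u v} → u ≈ v → E k u v
  E-reflexive {k} {u} {v} u≈v =
    mkE (≤-<ℝ-trans {d u v} {0ℝ} {const (ρ k)} (proj₁ (M.≈⇒0 u≈v)) (0<constρ k))

  ≈-refl : ∀ {u} → u ≈ u
  ≈-refl = IsEquivalence.refl ≈-isEquivalence

  ≈-sym : ∀ {u v} → u ≈ v → v ≈ u
  ≈-sym = IsEquivalence.sym ≈-isEquivalence

  ≈-trans : ∀ {u v w} → u ≈ v → v ≈ w → u ≈ w
  ≈-trans = IsEquivalence.trans ≈-isEquivalence

  E-≡ : ∀ {k u v} → u ≡ v → E k u v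
  E-≡ {u = u} refl = E-reflexive (≈-refl {u})

  E-resp : ∀ {k u u′ v v′} → u ≈ u′ → v ≈ v′ → E k u v → E k u′ v′
  E-resp {k} {u} {u′} {v} {v′} u≈u′ v≈v′ (mkE e) =
    mkE (≤-<ℝ-trans {d u′ v′} {d u v} {const (ρ k)} (proj₂ (M.cong u≈u′ v≈v′)) e)

  E-sym : ∀ {k u v} → E k u v → E k v u
  E-sym {k} {u} {v} (mkE e) = mkE (≤-<ℝ-trans {d v u} {d u v} {const (ρ k)} (proj₁ (M.sym v u)) e)

  -- Radii halve from one index to the next, so each use of the triangle inequality costs exactly
  -- one index.
  E-trans : ∀ {k u v w} → E (suc k) u v → E (suc k) v w → E k u w
  E-trans {k} {u} {v} {w} (mkE e) (mkE f) =
    mkE (≤-<ℝ-trans {d u w} {d u v +ℝ d v w} {const (ρ k)} (M.triangle u v w)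
      (subst (λ q → d u v +ℝ d v w <ℝ const q) (ρ-halves k)
        (+-mono-<const {d u v} {d v w} e f)))

  E-pred : ∀ {k u v} → E (suc k) u v → E k u v
  E-pred {k} {u} {v} (mkE e) =
    mkE (<const-trans {d u v} {ρ (suc k)} {const (ρ k)} e (0 , λ _ _ → ρ-decreasing k))

  E-mono : ∀ {k l u v} → k ≤ l → E l u v → E k u v
  E-mono k≤l e with ℕ.≤⇒≤′ k≤l
  ... | le = go le e
    where
    go : ∀ {k l u v} → k ℕ.≤′ l → E l u v → E k u v
    go (ℕ.≤′-reflexive refl) e = e
    go (ℕ.≤′-step le)        e = go le (E-pred e)

  E-separates : ∀ {u v} → (∀ k → E k u v) → u ≈ v
  E-separates {u} {v} e = M.0⇒≈ (d≤0 , M.nonNegative)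
    where
    d≤0 : d u v ≤ℝ 0ℝ
    d≤0 ε 0<ε with ρ-archimedean ε 0<ε
    ... | k , ρ≤ε with e k
    ... | mkE (δ , 0<δ , N , hN) = N , λ n ≤n → ℚ.≤-trans (p≤p+ε (seq (d u v) n) 0<δ)
      (ℚ.≤-trans (hN n ≤n) (ℚ.≤-trans ρ≤ε (ℚ.≤-reflexive (sym (ℚ.+-identityˡ ε)))))

  -- Passes from the real radii of the definitions to dyadic ones.
  E-below : ∀ ε → 0ℝ <ℝ ε → ∃ λ k → ∀ u v → E k u v → d u v <ℝ ε
  E-below ε (δ , 0<δ , N , hN) with ρ-archimedean δ 0<δ
  ... | k , ρ≤δ = k , λ u v (mkE e) → <const-trans {d u v} {ρ k} {ε} e
    (N , λ n ≤n → ℚ.≤-trans ρ≤δ (ℚ.≤-trans (ℚ.≤-reflexive (sym (ℚ.+-identityˡ δ))) (hN n ≤n)))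

-- Levels and holes

/ℕ-unique : ∀ d .{{_ : NonZero d}} s k → s < d → (+ s + k * + d) /ℕ d ≡ k
/ℕ-unique d@(suc _) s k s<d = ℤ.≤-antisym
  (below (ℤ.[n/ℕd]*d≤n n d) (subst (n ℤ.<_) (sym (ℤ.suc-* k (+ d))) (ℤ.+-monoˡ-< (k * + d) (ℤ.+<+ s<d))))
  (below (ℤ.i≤j+i (k * + d) (+ s)) (ℤ.n<s[n/ℕd]*d n d))
  where
  n = + s + k * + d
  below : ∀ {i j} → i * + d ℤ.≤ n → n ℤ.< ℤ.suc j * + d → i ℤ.≤ j
  below {i} {j} i≤n n<j = ℤ.≮⇒≥ λ j<i →
    ℤ.<⇒≱ (ℤ.*-cancelʳ-<-nonNeg {i} {ℤ.suc j} (+ d) (ℤ.≤-<-trans i≤n n<j)) (ℤ.i<j⇒suc[i]≤j j<i)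

pos-+* : ∀ s d n → + (s ℕ.+ d ℕ.* n) ≡ + s + + d * + n
pos-+* s d n = cong (_+_ (+ s)) (ℤ.pos-* d n)

module Levels {p : ℕ → ℕ} (fg : FastGrowing p) where
  open FastGrowing fg

  p-suc : ∀ i → p (suc i) ≡ ratio i ℕ.* p i
  p-suc i = ℕ.m∣n⇒n≡quotient*m (p-divides i)

  p-sucℤ : ∀ i → + p (suc i) ≡ + ratio i * + p i
  p-sucℤ i = trans (cong +_ (p-suc i)) (ℤ.pos-* (ratio i) (p i))

  2p≤p-suc : ∀ i → p i ℕ.+ p i ≤ p (suc i)
  2p≤p-suc i = begin
    p i ℕ.+ p i         ≡⟨ cong (p i ℕ.+_) (ℕ.+-identityʳ (p i)) ⟨
    2 ℕ.* p i           ≤⟨ ℕ.*-monoˡ-≤ (p i) (ℕ.≤-trans (ℕ.n≤1+n 2) (3≤ratio i)) ⟩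
    ratio i ℕ.* p i     ≡⟨ p-suc i ⟨
    p (suc i)           ∎
    where open ℕ.≤-Reasoning

  p-multiple : ∀ {j I} → j ≤ I → ∃ λ c → + p I ≡ c * + p j
  p-multiple j≤I = go (ℕ.≤⇒≤′ j≤I)
    where
    go : ∀ {j I} → j ℕ.≤′ I → ∃ λ c → + p I ≡ c * + p j
    go {j} (ℕ.≤′-reflexive refl) = 1ℤ , sym (ℤ.*-identityˡ (+ p j))
    go {j} {suc I} (ℕ.≤′-step le) with go le
    ... | c , eq = + ratio I * c , trans (p-sucℤ I)
      (trans (cong (_*_ (+ ratio I)) eq) (sym (ℤ.*-assoc (+ ratio I) c (+ p j))))

  -- Congruence modulo the periods and the selection rule

  infix 4 _≡_[mod-p_]

  -- Kept as an equation rather than as a divisibility, so that matching on it leaves identities for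
  -- the ring solver.
  record _≡_[mod-p_] (m n : ℤ) (I : ℕ) : Set where
    constructor congruent
    field
      quotient : ℤ
      equality : m ≡ n + quotient * + p I

  ≡p-refl : ∀ {m I} → m ≡ m [mod-p I ]
  ≡p-refl {m} {I} = congruent 0ℤ (sym (trans (cong (_+_ m) (ℤ.*-zeroˡ (+ p I))) (ℤ.+-identityʳ m)))

  ≡p-sym : ∀ {m n I} → m ≡ n [mod-p I ] → n ≡ m [mod-p I ]
  ≡p-sym {n = n} {I} (congruent t refl) = congruent (- t) (lemma n t (+ p I))
    where
    lemma : ∀ n t P → n ≡ n + t * P + - t * P
    lemma = solve-∀

  ≡p-trans : ∀ {m n o I} → m ≡ n [mod-p I ] → n ≡ o [mod-p I ] → m ≡ o [mod-p I ]
  ≡p-trans {o = o} {I} (congruent t refl) (congruent u refl) = congruent (u + t) (lemma o t u (+ p I))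
    where
    lemma : ∀ o t u P → o + u * P + t * P ≡ o + (u + t) * P
    lemma = solve-∀

  ≡p-+ : ∀ {m n I} s → m ≡ n [mod-p I ] → m + s ≡ n + s [mod-p I ]
  ≡p-+ {n = n} {I} s (congruent t refl) = congruent t (lemma n t s (+ p I))
    where
    lemma : ∀ n t s P → n + t * P + s ≡ n + s + t * P
    lemma = solve-∀

  ≡p-mono : ∀ {m n j I} → j ≤ I → m ≡ n [mod-p I ] → m ≡ n [mod-p j ]
  ≡p-mono {n = n} {j} j≤I (congruent t refl) with p-multiple j≤I
  ... | c , eq = congruent (t * c)
    (cong (_+_ n) (trans (cong (t *_) eq) (sym (ℤ.*-assoc t c (+ p j)))))

  ≡p-%ℕ : ∀ n I → + (n %ℕ p I) ≡ n [mod-p I ]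
  ≡p-%ℕ n I = ≡p-sym (congruent (n /ℕ p I) (ℤ.a≡a%ℕn+[a/ℕn]*n n (p I)))

  -- The selection rule freed from the sequence `x`, on which it does not depend.
  record Sel (i : ℕ) (k : ℤ) : Set where
    constructor sel
    field selected : ratio i ℕ.∣ ∣ k - -1ℤ ∣ ⊎ ratio i ℕ.∣ ∣ k ∣

  sel? : ∀ i k → Dec (Sel i k)
  sel? i k = map′ sel Sel.selected ((ratio i ℕ.∣? ∣ k - -1ℤ ∣) ⊎-dec (ratio i ℕ.∣? ∣ k ∣))

  Sel-+ : ∀ i k t → Sel i k → Sel i (k + t * + ratio i)
  Sel-+ i k t (sel s) = sel (⊎.map
    (λ h → subst (λ u → ratio i ℕ.∣ ∣ u ∣) (lemma k (t * + ratio i)) (shift (k - -1ℤ) h)) (shift k) s)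
    where
    lemma : ∀ k u → k + 1ℤ + u ≡ k + u + 1ℤ
    lemma = solve-∀
    shift : ∀ k → ratio i ℕ.∣ ∣ k ∣ → ratio i ℕ.∣ ∣ k + t * + ratio i ∣
    shift k h = ∣⇒∣ᵤ (∣m∣n⇒∣m+n (∣ᵤ⇒∣ {+ ratio i} {k} h) (divides t refl))

  Sel-+⁻ : ∀ i k t → Sel i (k + t * + ratio i) → Sel i k
  Sel-+⁻ i k t h = subst (Sel i) (lemma k t (+ ratio i)) (Sel-+ i _ (- t) h)
    where
    lemma : ∀ k t r → k + t * r + - t * r ≡ k
    lemma = solve-∀

  ¬Sel-inner : ∀ i d k → 1 ≤ d → suc d < ratio i → ¬ Sel i (+ d + k * + ratio i)
  ¬Sel-inner i (suc d) k _ d<r h with Sel-+⁻ i (+ suc d) k h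
  ... | sel (inj₁ r∣d) = ℕ.<⇒≱ (subst (_< ratio i) (sym (ℕ.+-comm (suc d) 1)) d<r) (ℕ.∣⇒≤ r∣d)
  ... | sel (inj₂ r∣d) = ℕ.<⇒≱ (ℕ.<-trans (ℕ.n<1+n (suc d)) d<r) (ℕ.∣⇒≤ r∣d)

  Sel-first : ∀ i k → Sel i (+ 0 + k * + ratio i)
  Sel-first i k = Sel-+ i (+ 0) k (sel (inj₂ (ratio i ℕ.∣0)))

  Sel-last : ∀ i d k → suc d ≡ ratio i → Sel i (+ d + k * + ratio i)
  Sel-last i d k eq = Sel-+ i (+ d) k (sel (inj₁ (ℕ.∣-reflexive (trans (sym eq) (sym (ℕ.+-comm d 1))))))

  -- Encoded through the selection rule, not as `stage I n ≡ nothing`, so that two Oxtoby sequences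
  -- with the same `p` share their holes.
  record Hole (I : ℕ) (n : ℤ) : Set where
    constructor hole
    field unselected : ∀ i → i < I → ¬ Sel i (n /ℕ p i)
  open Hole

  record HasLevel (i : ℕ) (n : ℤ) : Set where
    constructor _,_
    field
      undefined : Hole i n
      selected  : Sel i (n /ℕ p i)

  Hole-zero : ∀ {n} → Hole 0 n
  Hole-zero = hole λ _ ()

  Hole-pred : ∀ {I n} → Hole (suc I) n → Hole I n
  Hole-pred h = hole λ i i<I → unselected h i (ℕ.m<n⇒m<1+n i<I)

  Hole-suc : ∀ {I n} → Hole I n → ¬ Sel I (n /ℕ p I) → Hole (suc I) n
  Hole-suc {I} {n} h ¬s = hole go
    where
    go : ∀ i → i < suc I → ¬ Sel i (n /ℕ p i)
    go i i<1+I with ℕ.m≤n⇒m<n∨m≡n (ℕ.≤-pred i<1+I)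
    ... | inj₁ i<I  = unselected h i i<I
    ... | inj₂ refl = ¬s

  level-or-hole : ∀ I n → (∃ λ i → i < I × HasLevel i n) ⊎ Hole I n
  level-or-hole zero    n = inj₂ Hole-zero
  level-or-hole (suc I) n with level-or-hole I n
  ... | inj₁ (i , i<I , l) = inj₁ (i , ℕ.m<n⇒m<1+n i<I , l)
  ... | inj₂ h with sel? I (n /ℕ p I)
  ... | yes s = inj₁ (I , ℕ.n<1+n I , h , s)
  ... | no ¬s = inj₂ (Hole-suc h ¬s)

  module _ {a} {A : Set a} (x : ℕ → A) where
    open Oxtoby fg x

    stage-hole : ∀ I n → Hole I n → stage I n ≡ nothing
    stage-hole zero    n h = refl
    stage-hole (suc I) n h
      rewrite stage-hole I n (Hole-pred h)
            | dec-false (selected? I (n /ℕ p I)) (λ s → unselected h I (ℕ.n<1+n I) (sel s)) = refl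

    z-level : ∀ {i n} → HasLevel i n → z n ≡ x i
    z-level {i} {n} (h , sel s) = stage⇒z (suc i) n lemma
      where
      lemma : stage (suc i) n ≡ just (x i)
      lemma rewrite stage-hole i n h | dec-true (selected? i (n /ℕ p i)) s = refl

  level : ∀ n → ∃ λ i → HasLevel i n
  level n with level-or-hole (suc ∣ n ∣) n
  ... | inj₁ (i , _ , l) = i , l
  -- Totality of the construction, applied to the identity sequence: stage `suc ∣ n ∣` is already
  -- defined at `n`, whereas a hole would leave it at `nothing`.
  ... | inj₂ h with trans (sym (stage-hole (λ i → i) _ n h)) (proj₂ (Oxtoby.defined fg (λ i → i) n))
  ... | ()

  -- Moving by a multiple of `p (suc i)` changes the number of the block of length `p i` by a
  -- multiple of `ratio i`.
  Sel-cong : ∀ {i m n} → m ≡ n [mod-p suc i ] → Sel i (m /ℕ p i) → Sel i (n /ℕ p i)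
  Sel-cong {i} {m} {n} (congruent t refl) h =
    Sel-+⁻ i (n /ℕ p i) t (subst (Sel i) (trans (cong (_/ℕ p i) eq) (/ℕ-unique (p i) _ (n /ℕ p i + t * + ratio i) (ℤ.n%ℕd<d n (p i)))) h)
    where
    lemma : ∀ s q P t r → s + q * P + t * (r * P) ≡ s + (q + t * r) * P
    lemma = solve-∀
    eq : n + t * + p (suc i) ≡ + (n %ℕ p i) + (n /ℕ p i + t * + ratio i) * + p i
    eq = trans (cong₂ (λ u v → u + t * v) (ℤ.a≡a%ℕn+[a/ℕn]*n n (p i)) (p-sucℤ i))
      (lemma (+ (n %ℕ p i)) (n /ℕ p i) (+ p i) t (+ ratio i))

  Hole-cong : ∀ {I m n} → m ≡ n [mod-p I ] → Hole I m → Hole I n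
  Hole-cong m≡n h = hole λ i i<I s → unselected h i i<I (Sel-cong (≡p-sym (≡p-mono i<I m≡n)) s)

  Level-cong : ∀ {i m n} → m ≡ n [mod-p suc i ] → HasLevel i m → HasLevel i n
  Level-cong {i} m≡n (h , s) = Hole-cong (≡p-mono (ℕ.n≤1+n i) m≡n) h , Sel-cong m≡n s

  Sel-block : ∀ I s k → s < p I → Sel I ((+ s + k * + p I) /ℕ p I) → Sel I k
  Sel-block I s k s<p = subst (Sel I) (/ℕ-unique (p I) s k s<p)

  Sel-block⁻ : ∀ I s k → s < p I → Sel I k → Sel I ((+ s + k * + p I) /ℕ p I)
  Sel-block⁻ I s k s<p = subst (Sel I) (sym (/ℕ-unique (p I) s k s<p))

  -- Mixed radix expansion: the sub-block with digit `d` in block `k` of length `p (suc I)` is block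
  -- `d + k * ratio I` of length `p I`.
  carry : ∀ I s d k → + (s ℕ.+ d ℕ.* p I) + k * + p (suc I) ≡ + s + (+ d + k * + ratio I) * + p I
  carry I s d k = trans (cong₂ (λ u v → u + k * v) (pos-+* s d (p I)) (p-sucℤ I))
    (lemma (+ s) (+ d) k (+ p I) (+ ratio I))
    where
    lemma : ∀ s d k P r → s + d * P + k * (r * P) ≡ s + (d + k * r) * P
    lemma = solve-∀

  -- The holes of the block [k p I , (k + 1) p I) lie between k p I + first I and k p I + last I.
  first last : ℕ → ℕ
  first zero    = 0
  first (suc I) = first I ℕ.+ p I
  last zero    = 0
  last (suc I) = last I ℕ.+ (ratio I ℕ.∸ 2) ℕ.* p I

  -- The holes of a block lie symmetrically: the last is as far from the right end as the first is
  -- from the left end. This centres the long gap at the multiples of `p I`.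
  first+last : ∀ I → suc (first I ℕ.+ last I) ≡ p I
  first+last zero    = sym p₀≡1
  first+last (suc I) = begin
    suc (first I ℕ.+ p I ℕ.+ (last I ℕ.+ r-2 ℕ.* p I))   ≡⟨ lemma (first I) (last I) (p I) r-2 ⟩
    suc (first I ℕ.+ last I) ℕ.+ (1 ℕ.+ r-2) ℕ.* p I     ≡⟨ cong (ℕ._+ (1 ℕ.+ r-2) ℕ.* p I) (first+last I) ⟩
    (2 ℕ.+ r-2) ℕ.* p I                                  ≡⟨ cong (ℕ._* p I) (ℕ.m+[n∸m]≡n (ℕ.≤-trans (ℕ.n≤1+n 2) (3≤ratio I))) ⟩
    ratio I ℕ.* p I                                      ≡⟨ p-suc I ⟨
    p (suc I)                                            ∎
    where
    open ≡-Reasoning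
    r-2 = ratio I ℕ.∸ 2
    lemma : ∀ a b P q → suc (a ℕ.+ P ℕ.+ (b ℕ.+ q ℕ.* P)) ≡ suc (a ℕ.+ b) ℕ.+ (1 ℕ.+ q) ℕ.* P
    lemma = ℕSolver.solve-∀

  first<p : ∀ I → first I < p I
  first<p I = subst (first I <_) (first+last I) (s≤s (ℕ.m≤m+n _ _))

  last<p : ∀ I → last I < p I
  last<p I = subst (last I <_) (first+last I) (s≤s (ℕ.m≤n+m _ _))

  I≤first : ∀ I → I ≤ first I
  I≤first zero    = z≤n
  I≤first (suc I) = subst (_≤ first I ℕ.+ p I) (ℕ.+-comm I 1) (ℕ.+-mono-≤ (I≤first I) (ℕ.≤-trans (s≤s z≤n) (i<pᵢ I)))

  -- Used to keep a window of radius `first I` around the first hole of a block inside that block.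
  2first<p : ∀ I → first I ℕ.+ first I < p I
  2first<p zero    = i<pᵢ 0
  2first<p (suc I) = begin-strict
    first I ℕ.+ p I ℕ.+ (first I ℕ.+ p I)  ≡⟨ lemma (first I) (p I) ⟩
    first I ℕ.+ first I ℕ.+ 2 ℕ.* p I      <⟨ ℕ.+-monoˡ-< (2 ℕ.* p I) (2first<p I) ⟩
    3 ℕ.* p I                              ≤⟨ ℕ.*-monoˡ-≤ (p I) (3≤ratio I) ⟩
    ratio I ℕ.* p I                        ≡⟨ p-suc I ⟨
    p (suc I)                              ∎
    where
    open ℕ.≤-Reasoning
    lemma : ∀ a P → a ℕ.+ P ℕ.+ (a ℕ.+ P) ≡ a ℕ.+ a ℕ.+ 2 ℕ.* P
    lemma = ℕSolver.solve-∀

  -- Digit 0 is selected and digit 1 is not, as `ratio I` is at least 3. So the first hole of the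
  -- sub-block with digit 1 survives; for the last hole the digit is `ratio I ∸ 2`.
  first-hole : ∀ I k → Hole I (+ first I + k * + p I)
  first-hole zero    k = Hole-zero
  first-hole (suc I) k = subst (Hole (suc I))
    (trans (sym (carry I (first I) 1 k)) (cong (λ u → + (first I ℕ.+ u) + k * + p (suc I)) (ℕ.*-identityˡ (p I))))
    (Hole-suc (first-hole I (+ 1 + k * + ratio I)) λ s → ¬Sel-inner I 1 k ℕ.≤-refl (3≤ratio I) (Sel-block I (first I) _ (first<p I) s))

  last-hole : ∀ I k → Hole I (+ last I + k * + p I)
  last-hole zero    k = Hole-zero
  last-hole (suc I) k = subst (Hole (suc I)) (sym (carry I (last I) (ratio I ℕ.∸ 2) k))
    (Hole-suc (last-hole I (+ (ratio I ℕ.∸ 2) + k * + ratio I)) λ s → ¬Sel-inner I (ratio I ℕ.∸ 2) k (ℕ.∸-monoˡ-≤ 2 (3≤ratio I))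
      (ℕ.≤-reflexive (ℕ.m+[n∸m]≡n (ℕ.≤-trans (ℕ.n≤1+n 2) (3≤ratio I)))) (Sel-block I (last I) _ (last<p I) s))

  -- The digit of a surviving hole is neither 0 nor `ratio I` - 1, so a whole sub-block separates it
  -- from either end. The second bound says `s ≤ last I` without subtraction.
  hole-bounds : ∀ I s k → s < p I → Hole I (+ s + k * + p I) → first I ≤ s × first I ℕ.+ s < p I
  hole-bounds zero    s k s<p h = z≤n , s<p
  hole-bounds (suc I) s k s<p h = lower-bound , upper-bound
    where
    d = s ℕ./ p I
    s′ = s ℕ.% p I
    s′<p : s′ < p I
    s′<p = ℕ.m%n<n s (p I)
    s≡ : s ≡ s′ ℕ.+ d ℕ.* p I
    s≡ = ℕ.m≡m%n+[m/n]*n s (p I)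
    d<r : d < ratio I
    d<r = ℕ.m<n*o⇒m/o<n (subst (s <_) (p-suc I) s<p)
    h′ : Hole (suc I) (+ s′ + (+ d + k * + ratio I) * + p I)
    h′ = subst (Hole (suc I)) (trans (cong (λ u → + u + k * + p (suc I)) s≡) (carry I s′ d k)) h
    ¬sel : ¬ Sel I (+ d + k * + ratio I)
    ¬sel s = unselected h′ I (ℕ.n<1+n I) (Sel-block⁻ I s′ _ s′<p s)
    d≢0 : d ≢ 0
    d≢0 d≡0 = ¬sel (subst (λ u → Sel I (+ u + k * + ratio I)) (sym d≡0) (Sel-first I k))
    ih = hole-bounds I s′ (+ d + k * + ratio I) s′<p (Hole-pred h′)
    lower-bound : first I ℕ.+ p I ≤ s
    lower-bound = begin
      first I ℕ.+ p I        ≤⟨ ℕ.+-mono-≤ (proj₁ ih) (ℕ.m≤n*m (p I) d {{ℕ.≢-nonZero d≢0}}) ⟩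
      s′ ℕ.+ d ℕ.* p I       ≡⟨ s≡ ⟨
      s                      ∎
      where open ℕ.≤-Reasoning
    1+d<r : suc d < ratio I
    1+d<r = ℕ.≤∧≢⇒< d<r λ eq → ¬sel (Sel-last I d k eq)
    upper-bound : first I ℕ.+ p I ℕ.+ s < p (suc I)
    upper-bound = begin-strict
      first I ℕ.+ p I ℕ.+ s                   ≡⟨ cong (first I ℕ.+ p I ℕ.+_) s≡ ⟩
      first I ℕ.+ p I ℕ.+ (s′ ℕ.+ d ℕ.* p I)  ≡⟨ lemma (first I) (p I) s′ (d ℕ.* p I) ⟩
      first I ℕ.+ s′ ℕ.+ suc d ℕ.* p I        <⟨ ℕ.+-monoˡ-< (suc d ℕ.* p I) (proj₂ ih) ⟩
      suc (suc d) ℕ.* p I                     ≤⟨ ℕ.*-monoˡ-≤ (p I) 1+d<r ⟩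
      ratio I ℕ.* p I                         ≡⟨ p-suc I ⟨
      p (suc I)                               ∎
      where
      open ℕ.≤-Reasoning
      lemma : ∀ a P s q → a ℕ.+ P ℕ.+ (s ℕ.+ q) ≡ a ℕ.+ s ℕ.+ (P ℕ.+ q)
      lemma = ℕSolver.solve-∀

  -- The right half of the interval lies in block `k` before its first hole, the left half in block
  -- `k - 1` after its last.
  central-gap : ∀ I k u → u < first I ℕ.+ first I → ¬ Hole I (k * + p I - + first I + + u)
  central-gap I k u u<2a h with ℕ.<-≤-connex u (first I)
  ... | inj₂ a≤u with ℕ.m+[n∸m]≡n a≤u
  ... | a+v≡u = ℕ.<⇒≱ v<a (proj₁ (hole-bounds I v k (ℕ.<-trans v<a (first<p I)) (subst (Hole I) eq h)))
    where
    v = u ℕ.∸ first I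
    v<a : v < first I
    v<a = ℕ.+-cancelˡ-< (first I) v (first I) (subst (_< first I ℕ.+ first I) (sym a+v≡u) u<2a)
    lemma : ∀ k a v → k + - a + (a + v) ≡ v + k
    lemma = solve-∀
    eq : k * + p I - + first I + + u ≡ + v + k * + p I
    eq = trans (cong (λ w → k * + p I - + first I + + w) (sym a+v≡u)) (lemma (k * + p I) (+ first I) (+ v))
  central-gap I k u u<2a h | inj₁ u<a =
    ℕ.<⇒≱ (proj₂ (hole-bounds I s (k + -1ℤ) s<p (subst (Hole I) eq h)))
      (ℕ.≤-trans (ℕ.m≤m+n (p I) u) (ℕ.≤-reflexive p+u≡))
    where
    c = suc (last I)
    s = c ℕ.+ u
    a+c≡p : first I ℕ.+ c ≡ p I
    a+c≡p = trans (ℕ.+-suc (first I) (last I)) (first+last I)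
    p+u≡ : p I ℕ.+ u ≡ first I ℕ.+ s
    p+u≡ = trans (cong (ℕ._+ u) (sym a+c≡p)) (ℕ.+-assoc (first I) c u)
    s<p : s < p I
    s<p = subst (s <_) (trans (ℕ.+-comm c (first I)) a+c≡p) (ℕ.+-monoʳ-< c u<a)
    lemma : ∀ k a c u → k * (a + c) + - a + u ≡ c + u + (k + -1ℤ) * (a + c)
    lemma = solve-∀
    eq : k * + p I - + first I + + u ≡ + s + (k + -1ℤ) * + p I
    eq = subst (λ P → k * + P - + first I + + u ≡ + s + (k + -1ℤ) * + P) a+c≡p
      (lemma k (+ first I) (+ c) (+ u))

  -- The interval [lo , lo + 2b) contains a whole block of length p I.  Having no hole, this block is
  -- adjacent to a multiple of p (suc I), and the holes nearest to that multiple delimit the interval.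
  gap-position : ∀ I lo b l → first (suc I) ≡ b ℕ.+ l → p I ≤ b →
    (∀ u → u < b ℕ.+ b → ¬ Hole (suc I) (lo + + u)) →
    ∃ λ e → (lo + + e ≡ 0ℤ [mod-p suc I ]) × b ≤ e ℕ.+ l × e ≤ b ℕ.+ l
  gap-position I lo b l a≡b+l p≤b ¬hole = result
    where
    P = p I
    s = lo %ℕ P
    q = lo /ℕ P
    e₀ = P ℕ.∸ s
    s+e₀≡P : s ℕ.+ e₀ ≡ P
    s+e₀≡P = ℕ.m+[n∸m]≡n (ℕ.<⇒≤ (ℤ.n%ℕd<d lo P))
    block : lo + + e₀ ≡ (q + 1ℤ) * + P
    block = begin
      lo + + e₀                    ≡⟨ cong (_+ + e₀) (ℤ.a≡a%ℕn+[a/ℕn]*n lo P) ⟩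
      + s + q * + P + + e₀         ≡⟨ lemma (+ s) (+ e₀) (q * + P) ⟩
      q * + P + + (s ℕ.+ e₀)       ≡⟨ cong (λ u → q * + P + + u) s+e₀≡P ⟩
      q * + P + + P                ≡⟨ lemma′ q (+ P) ⟩
      (q + 1ℤ) * + P               ∎
      where
      open ≡-Reasoning
      lemma : ∀ s e u → s + u + e ≡ u + (s + e)
      lemma = solve-∀
      lemma′ : ∀ q P → q * P + P ≡ (q + 1ℤ) * P
      lemma′ = solve-∀
    e₀≤P : e₀ ≤ P
    e₀≤P = ℕ.m∸n≤m P s
    finish : ∀ e t → lo + + e ≡ t * + p (suc I) → e ≤ b ℕ.+ b →
      ∃ λ e → (lo + + e ≡ 0ℤ [mod-p suc I ]) × b ≤ e ℕ.+ l × e ≤ b ℕ.+ l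
    finish e t eq e≤2b = e , congruent t (trans eq (sym (ℤ.+-identityˡ _))) , ℕ.≮⇒≥ low , ℕ.≮⇒≥ high
      where
      a = first (suc I)
      -- Were the multiple too far to the left, the first hole after it, at distance `a`, would fall
      -- into the interval. `high` is the mirror image, with the last hole before the multiple.
      low : ¬ e ℕ.+ l < b
      low e+l<b = ¬hole (e ℕ.+ a) (begin-strict
        e ℕ.+ a            ≡⟨ cong (e ℕ.+_) a≡b+l ⟩
        e ℕ.+ (b ℕ.+ l)    ≡⟨ lemma e b l ⟩
        e ℕ.+ l ℕ.+ b      <⟨ ℕ.+-monoˡ-< b e+l<b ⟩
        b ℕ.+ b            ∎)
        (subst (Hole (suc I)) (shifted) (first-hole (suc I) t))
        where
        open ℕ.≤-Reasoning
        lemma : ∀ e b l → e ℕ.+ (b ℕ.+ l) ≡ e ℕ.+ l ℕ.+ b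
        lemma = ℕSolver.solve-∀
        shifted : + a + t * + p (suc I) ≡ lo + + (e ℕ.+ a)
        shifted = trans (cong (_+_ (+ a)) (sym eq)) (lemma′ (+ a) lo (+ e))
          where
          lemma′ : ∀ a lo e → a + (lo + e) ≡ lo + (e + a)
          lemma′ = solve-∀
      high : ¬ b ℕ.+ l < e
      high b+l<e = ¬hole f (ℕ.<-≤-trans f<e e≤2b) (subst (Hole (suc I)) eq′ (last-hole (suc I) (t + -1ℤ)))
        where
        f = e ℕ.∸ suc a
        f+ : suc a ℕ.+ f ≡ e
        f+ = ℕ.m+[n∸m]≡n (subst (λ u → suc u ≤ e) (sym a≡b+l) b+l<e)
        f<e : f < e
        f<e = subst (f <_) f+ (ℕ.m<n+m f (s≤s z≤n))
        lemma₁ : ∀ c t P → c + (t + -1ℤ) * P ≡ t * P + - P + c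
        lemma₁ = solve-∀
        lemma₂ : ∀ a f c lo → lo + (1ℤ + a + f) + - (1ℤ + (a + c)) + c ≡ lo + f
        lemma₂ = solve-∀
        eq′ : + last (suc I) + (t + -1ℤ) * + p (suc I) ≡ lo + + f
        eq′ = trans (lemma₁ (+ last (suc I)) t (+ p (suc I)))
          (trans (cong₂ (λ u v → u + - (+ v) + + last (suc I))
                        (trans (sym eq) (cong (λ u → lo + + u) (sym f+))) (sym (first+last (suc I))))
                 (lemma₂ (+ a) (+ f) (+ last (suc I)) lo))
    P+P≤2b : P ℕ.+ P ≤ b ℕ.+ b
    P+P≤2b = ℕ.+-mono-≤ p≤b p≤b
    multiple : ∀ t k → k ≡ t * + ratio I → k * + P ≡ t * + p (suc I)
    multiple t k refl = trans (ℤ.*-assoc t (+ ratio I) (+ P)) (cong (t *_) (sym (p-sucℤ I)))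
    result : ∃ λ e → (lo + + e ≡ 0ℤ [mod-p suc I ]) × b ≤ e ℕ.+ l × e ≤ b ℕ.+ l
    result with sel? I (q + 1ℤ)
    -- An unselected block would keep its first hole.
    ... | no ¬s = ⊥-elim (¬hole (e₀ ℕ.+ first I) (ℕ.<-≤-trans (ℕ.+-mono-≤-< e₀≤P (first<p I)) P+P≤2b)
      (subst (Hole (suc I)) eq (Hole-suc (first-hole I (q + 1ℤ)) (λ s → ¬s (Sel-block I (first I) _ (first<p I) s)))))
      where
      lemma : ∀ a lo e → a + (lo + e) ≡ lo + (e + a)
      lemma = solve-∀
      eq : + first I + (q + 1ℤ) * + P ≡ lo + + (e₀ ℕ.+ first I)
      eq = trans (cong (_+_ (+ first I)) (sym block)) (lemma (+ first I) lo (+ e₀))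
    ... | yes (sel (inj₂ r∣)) with ∣ᵤ⇒∣ {+ ratio I} {q + 1ℤ} r∣
    ... | divides t k≡ = finish e₀ t (trans block (multiple t (q + 1ℤ) k≡)) (ℕ.≤-trans e₀≤P (ℕ.≤-trans (ℕ.m≤m+n P P) P+P≤2b))
    -- Here the multiple of `p (suc I)` is the right end of the block, not its left end; hence
    -- `e₀ + P`.
    result | yes (sel (inj₁ r∣)) with ∣ᵤ⇒∣ {+ ratio I} {q + 1ℤ + 1ℤ} r∣
    ... | divides t k≡ = finish (e₀ ℕ.+ P) t
      (trans (lemma lo (+ e₀) (+ P)) (trans (cong (_+ + P) block) (trans (lemma′ (q + 1ℤ) (+ P)) (multiple t (q + 1ℤ + 1ℤ) k≡))))
      (ℕ.≤-trans (ℕ.+-monoˡ-≤ P e₀≤P) P+P≤2b)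
      where
      lemma : ∀ lo e P → lo + (e + P) ≡ lo + e + P
      lemma = solve-∀
      lemma′ : ∀ q P → q * P + P ≡ (q + 1ℤ) * P
      lemma′ = solve-∀

  -- Give the residue of `n` modulo `p I` the digit 1, never selected, at the steps from `I` to
  -- `j - 1`, and the digit 0, always selected, at step `j`. The result `v` has level `j`, and `e`
  -- carries `n` into its class modulo `p (suc j)`.
  hole-spread : ∀ {I j} n → Hole I n → I ≤ j → ∃ λ e → e < p (suc j) × HasLevel j (n + + e) × + e ≡ 0ℤ [mod-p I ]
  hole-spread {I} {j} n h I≤j with start (ℕ.≤⇒≤′ I≤j)
    where
    start : ∀ {j} → I ℕ.≤′ j → ∃ λ v → v < p j × Hole j (+ v) × + v ≡ n [mod-p I ]
    start (ℕ.≤′-reflexive refl) =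
      n %ℕ p I , ℤ.n%ℕd<d n (p I) , Hole-cong (≡p-sym (≡p-%ℕ n I)) h , ≡p-%ℕ n I
    start {suc j} (ℕ.≤′-step le) with start le
    ... | v , v<p , hv , v≡n = v ℕ.+ p j , ℕ.<-≤-trans (ℕ.+-monoˡ-< (p j) v<p) (2p≤p-suc j) ,
      subst (Hole (suc j)) (cong (_+_ (+ v)) (ℤ.*-identityˡ (+ p j)))
        (Hole-suc (Hole-cong (≡p-sym (congruent 1ℤ refl)) hv)
          λ s → ¬Sel-inner j 1 0ℤ ℕ.≤-refl (3≤ratio j) (Sel-+ j 1ℤ 0ℤ (Sel-block j v 1ℤ v<p s))) ,
      ≡p-trans (≡p-mono (ℕ.≤′⇒≤ le) (congruent 1ℤ (cong (_+_ (+ v)) (sym (ℤ.*-identityˡ (+ p j)))))) v≡n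
  ... | v , v<p , hv , v≡n = e , ℤ.n%ℕd<d w P , Level-cong v≡ lv ,
    subst₂ (λ s t → s ≡ t [mod-p I ]) (lemma₁ n (+ e)) (ℤ.+-inverseʳ n)
      (≡p-+ (- n) (≡p-trans (≡p-sym (≡p-mono (ℕ.m≤n⇒m≤1+n I≤j) v≡)) v≡n))
    where
    P = p (suc j)
    w = + v - n
    e = w %ℕ P
    lv : HasLevel j (+ v)
    lv = hv , subst (λ u → Sel j (u /ℕ p j)) (trans (cong (_+_ (+ v)) (ℤ.*-zeroˡ (+ p j))) (ℤ.+-identityʳ (+ v)))
      (Sel-block⁻ j v 0ℤ v<p (sel (inj₂ (ratio j ℕ.∣0))))
    lemma₀ : ∀ v n → v ≡ n + (v + - n)
    lemma₀ = solve-∀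
    lemma₁ : ∀ n e → n + e + - n ≡ e
    lemma₁ = solve-∀
    v≡ : + v ≡ n + + e [mod-p suc j ]
    v≡ = congruent (w /ℕ P) (trans (lemma₀ (+ v) n) (trans (cong (_+_ n) (ℤ.a≡a%ℕn+[a/ℕn]*n w P)) (sym (ℤ.+-assoc n (+ e) _))))

  -- Levels within one block

  /ℕ-suc : ∀ j n → n /ℕ p (suc j) ≡ _/ℕ_ (n /ℕ p j) (ratio j) {{ℕ.>-nonZero (ℕ.≤-trans (s≤s z≤n) (3≤ratio j))}}
  /ℕ-suc j n = trans (cong (_/ℕ p (suc j)) eq) (/ℕ-unique (p (suc j)) (s ℕ.+ s₂ ℕ.* p j) q₂ bound)
    where
    instance r≢0 = ℕ.>-nonZero (ℕ.≤-trans (s≤s z≤n) (3≤ratio j))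
    s = n %ℕ p j
    q = n /ℕ p j
    s₂ = q %ℕ ratio j
    q₂ = q /ℕ ratio j
    eq : n ≡ + (s ℕ.+ s₂ ℕ.* p j) + q₂ * + p (suc j)
    eq = trans (ℤ.a≡a%ℕn+[a/ℕn]*n n (p j)) (trans (cong (λ u → + s + u * + p j) (ℤ.a≡a%ℕn+[a/ℕn]*n q (ratio j)))
      (sym (carry j s s₂ q₂)))
    bound : s ℕ.+ s₂ ℕ.* p j < p (suc j)
    bound = begin-strict
      s ℕ.+ s₂ ℕ.* p j       <⟨ ℕ.+-monoˡ-< _ (ℤ.n%ℕd<d n (p j)) ⟩
      suc s₂ ℕ.* p j         ≤⟨ ℕ.*-monoˡ-≤ (p j) (ℤ.n%ℕd<d q (ratio j)) ⟩
      ratio j ℕ.* p j        ≡⟨ p-suc j ⟨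
      p (suc j)              ∎
      where open ℕ.≤-Reasoning

  same-block : ∀ {I j m n} → I ≤ j → m /ℕ p I ≡ n /ℕ p I → m /ℕ p j ≡ n /ℕ p j
  same-block {I} {m = m} {n} I≤j eq = go (ℕ.≤⇒≤′ I≤j)
    where
    go : ∀ {j} → I ℕ.≤′ j → m /ℕ p j ≡ n /ℕ p j
    go (ℕ.≤′-reflexive refl) = eq
    go {suc j} (ℕ.≤′-step le) = trans (/ℕ-suc j m) (trans (cong (λ u → u /ℕ ratio j) (go le)) (sym (/ℕ-suc j n)))
      where instance r≢0 = ℕ.>-nonZero (ℕ.≤-trans (s≤s z≤n) (3≤ratio j))

  Hole-block : ∀ {I j m n} → m /ℕ p I ≡ n /ℕ p I → Hole I n → Hole j m → Hole j n
  Hole-block {I} {j} {m} {n} eq hn hm = hole go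
    where
    go : ∀ i → i < j → ¬ Sel i (n /ℕ p i)
    go i i<j s with ℕ.<-≤-connex i I
    ... | inj₁ i<I = unselected hn i i<I s
    ... | inj₂ I≤i = unselected hm i i<j (subst (Sel i) (sym (same-block {m = m} {n} I≤i eq)) s)

  -- From step `I` on a block of length `p I` is treated as a whole, so all its `I`-holes are filled
  -- together.
  Level-block : ∀ {I j m n} → I ≤ j → m /ℕ p I ≡ n /ℕ p I → Hole I n → HasLevel j m → HasLevel j n
  Level-block {j = j} {m} {n} I≤j eq hn (hm , s) =
    Hole-block eq hn hm , subst (Sel j) (same-block {m = m} {n} I≤j eq) s

  hole-level : ∀ {I i n} → Hole I n → HasLevel i n → I ≤ i
  hole-level {I} {i} h (_ , s) = ℕ.≮⇒≥ λ i<I → unselected h i i<I s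

  -- An `i`-hole in block 0, which step `i` selects: a standard position at which to read off the
  -- entry with index `i`.
  first-level : ∀ i → HasLevel i (+ first i)
  first-level i = subst (HasLevel i) (trans (cong (_+_ (+ first i)) (ℤ.*-zeroˡ (+ p i))) (ℤ.+-identityʳ (+ first i)))
    (first-hole i 0ℤ , Sel-block⁻ i (first i) 0ℤ (first<p i) (sel (inj₂ (ratio i ℕ.∣0))))

  -- `first i` is the sum of the `p j` with `j < i`, and the terms from `p I` on are multiples of
  -- `p I`.
  first-mod : ∀ {I i} → I ≤ i → + first i ≡ + first I [mod-p I ]
  first-mod {I} I≤i = go (ℕ.≤⇒≤′ I≤i)
    where
    go : ∀ {i} → I ℕ.≤′ i → + first i ≡ + first I [mod-p I ]
    go (ℕ.≤′-reflexive refl) = ≡p-refl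
    go {suc i} (ℕ.≤′-step le) = ≡p-trans
      (≡p-mono (ℕ.≤′⇒≤ le) (congruent 1ℤ (cong (_+_ (+ first i)) (sym (ℤ.*-identityˡ (+ p i)))))) (go le)

  -- The only link between an Oxtoby sequence and its entries that the arguments below rely on.
  Reads : ∀ {a} {A : Set a} → (ℕ → A) → (ℤ → A) → Set a
  Reads x z = ∀ {i n} → HasLevel i n → z n ≡ x i

  -- Off the `I`-holes the level is some `i < I`, and the class modulo `p (suc i)` determines it.
  reads-periodic : ∀ {a} {A : Set a} {x : ℕ → A} {z : ℤ → A} → Reads x z →
    ∀ {I m n} → m ≡ n [mod-p I ] → ¬ Hole I n → z m ≡ z n
  reads-periodic reads {I} {m} {n} m≡n ¬h with level-or-hole I n
  ... | inj₁ (i , i<I , l) = trans (reads (Level-cong (≡p-sym (≡p-mono i<I m≡n)) l)) (sym (reads l))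
  ... | inj₂ h = contradiction h ¬h

-- Compactness of X and of the full shift

decide : ∀ {a} b → ExcludedMiddle (a ⊔ b) → (A : Set a) → Dec A
decide b em A = map′ lower lift (em {Lift b A})

interval : ℕ → List ℤ
interval zero    = 0ℤ ∷ []
interval (suc k) = + suc k ∷ -[1+ k ] ∷ interval k

interval-complete : ∀ {ℓ} {P : ℤ → Set ℓ} k → All P (interval k) → ∀ t → ∣ t ∣ ≤ k → P t
interval-complete zero (h ∷ []) (+ zero) _ = h
interval-complete (suc k) (h ∷ h′ ∷ hs) t t≤ with ℕ.m≤n⇒m<n∨m≡n t≤
... | inj₁ t<  = interval-complete k hs t (ℕ.≤-pred t<)
interval-complete (suc k) (h ∷ h′ ∷ hs) (+ _)    t≤ | inj₂ refl = h
interval-complete (suc k) (h ∷ h′ ∷ hs) -[1+ _ ] t≤ | inj₂ refl = h′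

index : ℤ → ℕ
index (+ n)    = n ℕ.+ n
index -[1+ n ] = suc (n ℕ.+ n)

unindex : ℕ → ℤ
unindex zero    = 0ℤ
unindex (suc l) = next (unindex l)
  where
  next : ℤ → ℤ
  next (+ n)    = -[1+ n ]
  next -[1+ n ] = + suc n

unindex-index : ∀ n → unindex (index n) ≡ n
unindex-index (+ n) = even n
  where
  even : ∀ n → unindex (n ℕ.+ n) ≡ + n
  even zero = refl
  even (suc n) rewrite ℕ.+-suc n n | even n = refl
unindex-index -[1+ n ] rewrite unindex-index (+ n) = refl

index-bound : ∀ {K} t → ∣ t ∣ ≤ K → index t ≤ K ℕ.+ K
index-bound (+ n)    n≤K = ℕ.+-mono-≤ n≤K n≤K
index-bound -[1+ n ] n<K = ℕ.+-mono-≤ n<K (ℕ.<⇒≤ n<K)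

≤-+ : ∀ {k} l m → k ≤ l ⊎ k ≤ m → k ≤ l ℕ.+ m
≤-+ l m (inj₁ h) = ℕ.≤-trans h (ℕ.m≤m+n l m)
≤-+ l m (inj₂ h) = ℕ.≤-trans h (ℕ.m≤n+m m l)

module Compactness {a ℓ} (em : ExcludedMiddle (a ⊔ ℓ)) (X : MetricSpace a ℓ) (compact : IsCompact X) where
  open MetricSpace X
  open Uniformity X public

  decide₀ : (A : Set) → Dec A
  decide₀ = decide (a ⊔ ℓ) em

  decideₐ : (A : Set a) → Dec A
  decideₐ = decide ℓ em

  ¬∀⇒∃¬ : {B : ℕ → Set} → ¬ (∀ k → B k) → ∃ λ k → ¬ B k
  ¬∀⇒∃¬ {B} ¬∀ = decidable-stable (decide₀ _) λ ¬∃ →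
    ¬∀ λ k → decidable-stable (decide₀ (B k)) λ ¬b → ¬∃ (k , ¬b)

  ClusterPoint : (ℕ → Carrier) → Carrier → Set
  ClusterPoint y L = ∀ k M → ∃ λ j → M ≤ j × E k L (y j)

  -- Without a cluster point, the open sets `U` of points with a ball that the tail from `M` avoids
  -- would cover the space. Beyond the indices of a finite subcover, `y N` lies in none of them.
  cluster-point : ∀ y → ∃ (ClusterPoint y)
  cluster-point y = decidable-stable (decideₐ _) λ none →
    let (Ms , covers) = compact (Lift (a ⊔ ℓ) ℕ) U U-open λ L → U-covers L (λ c → none (L , c))
        (N , N-bounds) = bound Ms
    in N-bounds (y N) (ℕ.≤-refl) (covers (y N))
    where
    Avoids : ℕ → Carrier → Set
    Avoids M L = ∃ λ k → ∀ j → M ≤ j → ¬ E k L (y j)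

    U : Lift (a ⊔ ℓ) ℕ → Pred Carrier (a ⊔ ℓ)
    U (lift M) L = Lift (a ⊔ ℓ) (Avoids M L)

    U-open : ∀ i → IsOpen X (U i)
    U-open (lift M) L (lift (k , avoids)) = const (ρ (suc k)) , 0<constρ (suc k) ,
      λ L′ near → lift (suc k , λ j M≤j e → avoids j M≤j (E-trans (toE (suc k) L L′ near) e))

    U-covers : ∀ L → ¬ ClusterPoint y L → ∃ λ i → U i L
    U-covers L ¬c with decide₀ (∃ λ M → Avoids M L)
    ... | yes (M , av) = lift M , lift av
    ... | no ¬∃ = ⊥-elim (¬c λ k M → decidable-stable (decide₀ _) λ ¬e →
      ¬∃ (M , k , λ j M≤j e → ¬e (j , M≤j , e)))

    bound : ∀ Ms → ∃ λ N → ∀ L → ∀ {j} → N ≤ j → ¬ Any (λ i → U i (y j)) Ms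
    bound [] = 0 , λ _ _ ()
    bound (lift M ∷ Ms) with bound Ms
    ... | N , ih = M ℕ.+ N , λ
      { L N≤j (here (lift (k , av))) → av _ (ℕ.≤-trans (ℕ.m≤m+n M N) N≤j) (E-reflexive ≈-refl)
      ; L N≤j (there any) → ih L (ℕ.≤-trans (ℕ.m≤n+m N M) N≤j) any }

  Cauchyᴱ : (ℕ → Carrier) → Set
  Cauchyᴱ y = ∀ k → ∃ λ N → ∀ i j → N ≤ i → N ≤ j → E k (y i) (y j)

  Limit : (ℕ → Carrier) → Carrier → Set
  Limit y L = ∀ k → ∃ λ N → ∀ i → N ≤ i → E k L (y i)

  cauchy⇒limit : ∀ {y} → Cauchyᴱ y → ∃ (Limit y)
  cauchy⇒limit {y} cauchy with cluster-point y
  ... | L , cluster = L , λ k →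
    let (N , close) = cauchy (suc k)
        (j , N≤j , e) = cluster (suc k) N
    in N , λ i N≤i → E-trans e (close j i N≤j N≤i)

  limit⇒converges : ∀ y {L} → Limit y L → Converges X y
  limit⇒converges y {L} lim = L , λ ε 0<ε →
    let (k , below) = E-below ε 0<ε
        (N , close) = lim k
    in N , λ i N≤i → below (y i) L (E-sym (close i N≤i))

  converges⇒cauchy : ∀ y → Converges X y → Cauchyᴱ y
  converges⇒cauchy y (L , conv) k with conv (const (ρ (suc k))) (0<constρ (suc k))
  ... | N , close = N , λ i j N≤i N≤j → E-trans (toE (suc k) (y i) L (close i N≤i)) (E-sym (toE (suc k) (y j) L (close j N≤j)))

  -- One index measures both the radius of the window and the precision inside it; these relations
  -- form a base of the product uniformity.
  record W (k : ℕ) (u v : Config X) : Set where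
    constructor window
    field at : ∀ t → ∣ t ∣ ≤ k → E k (u t) (v t)
  open W public

  W-refl : ∀ {k u} → W k u u
  W-refl = window λ _ _ → E-reflexive ≈-refl

  W-sym : ∀ {k u v} → W k u v → W k v u
  W-sym h = window λ t t≤k → E-sym (at h t t≤k)

  W-trans : ∀ {k u v w} → W (suc k) u v → W (suc k) v w → W k u w
  W-trans g h = window λ t t≤k → E-trans (at g t (ℕ.m≤n⇒m≤1+n t≤k)) (at h t (ℕ.m≤n⇒m≤1+n t≤k))

  W-mono : ∀ {k l u v} → k ≤ l → W l u v → W k u v
  W-mono k≤l h = window λ t t≤k → E-mono k≤l (at h t (ℕ.≤-trans t≤k k≤l))

  W-separates : ∀ {u v} → (∀ k → W k u v) → ∀ t → u t ≈ v t
  W-separates h t = E-separates λ k → E-mono (ℕ.m≤m+n k ∣ t ∣) (at (h (k ℕ.+ ∣ t ∣)) t (ℕ.m≤n+m ∣ t ∣ k))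

  W⇒Near : ∀ F ε → 0ℝ <ℝ ε → ∃ λ k → ∀ {u v} → W k u v → Near X F ε u v
  W⇒Near F ε 0<ε with E-below ε 0<ε
  ... | l , below = go F
    where
    go : ∀ F → ∃ λ k → ∀ {u v} → W k u v → Near X F ε u v
    go [] = 0 , λ _ → []
    go (n ∷ F) with go F
    ... | k , near = k ℕ.+ (l ℕ.+ ∣ n ∣) , λ {u} {v} h →
      below (u n) (v n) (E-mono (≤-+ k _ (inj₂ (ℕ.m≤m+n l ∣ n ∣))) (at h n (≤-+ k _ (inj₂ (ℕ.m≤n+m ∣ n ∣ l)))))
      ∷ near (W-mono (ℕ.m≤m+n k _) h)

  Near⇒W : ∀ k {u v} → Near X (interval k) (const (ρ k)) u v → W k u v
  Near⇒W k {u} {v} near = window λ t t≤k → toE k (u t) (v t) (interval-complete k near t t≤k)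

  InOrbitClosure : Config X → Config X → Set
  InOrbitClosure z w = ∀ k → ∃ λ n → W k w (S^ X n z)

  closure⇒ : ∀ {z w} → OrbitClosure X z w → InOrbitClosure z w
  closure⇒ w∈ k with w∈ (interval k) (const (ρ k)) (0<constρ k)
  ... | n , near = n , Near⇒W k near

  closure⇐ : ∀ {z w} → InOrbitClosure z w → OrbitClosure X z w
  closure⇐ w∈ F ε 0<ε with W⇒Near F ε 0<ε
  ... | k , near with w∈ k
  ... | n , h = n , near h

  orbitPoint : ∀ z → ℤ → Subsystem.Point (OrbitSystem X z)
  orbitPoint z m = S^ X m z , closure⇐ {z} λ k → m , W-refl

  -- Cantor's diagonal argument: `s (suc l)` refines `s l` so that coordinate `l` converges, and
  -- `s k k` is eventually a refinement of each of them. The chosen indices need not increase; it is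
  -- enough that they tend to infinity.
  diagonal : (u : ℕ → ℕ → Carrier) →
    ∃₂ λ (y : ℕ → Carrier) (D : ℕ → ℕ) → (∀ k → k ≤ D k) × (∀ {l k} → l < k → E k (y l) (u (D k) l))
  diagonal u = limit , (λ k → s k k) , (λ k → s-expands k k) , close
    where
    s : ℕ → ℕ → ℕ
    refine : ∀ l → ∃ λ L → ∀ k M → ∃ λ j → M ≤ j × E k L (u (s l j) l)
    s zero    k = k
    s (suc l) k = s l (proj₁ (proj₂ (refine l) k k))
    refine l = cluster-point (λ i → u (s l i) l)
    limit : ℕ → Carrier
    limit l = proj₁ (refine l)
    s-expands : ∀ l k → k ≤ s l k
    s-expands zero    k = ℕ.≤-refl
    s-expands (suc l) k = ℕ.≤-trans (proj₁ (proj₂ (proj₂ (refine l) k k))) (s-expands l _)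
    s-tail : ∀ {l m} → l ℕ.≤′ m → ∀ k → ∃ λ q → k ≤ q × s m k ≡ s l q
    s-tail (ℕ.≤′-reflexive refl) k = k , ℕ.≤-refl , refl
    s-tail {m = suc m} (ℕ.≤′-step le) k with proj₂ (refine m) k k
    ... | j , k≤j , _ with s-tail le j
    ... | q , j≤q , eq = q , ℕ.≤-trans k≤j j≤q , eq
    close : ∀ {l k} → l < k → E k (limit l) (u (s k k) l)
    close {l} {k} l<k with s-tail (ℕ.≤⇒≤′ l<k) k
    ... | q , k≤q , eq rewrite eq = E-mono k≤q (proj₂ (proj₂ (proj₂ (refine l) q q)))

  cluster-config : (u : ℕ → Config X) → ∃ λ w → ∀ K → ∃ λ i → K ≤ i × W K w (u i)
  cluster-config u with diagonal (λ i l → u i (unindex l))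
  ... | y , D , k≤D , close = (λ t → y (index t)) , λ K →
    -- The coordinates of the window of radius `K` have index at most `2K`, and `close` needs an
    -- index below `k`.
    let k = suc (K ℕ.+ K)
        K≤k = ℕ.≤-trans (ℕ.m≤m+n K K) (ℕ.n≤1+n _)
    in D k , ℕ.≤-trans K≤k (k≤D k) , window λ t t≤K →
       E-mono K≤k (subst (λ n → E k (y (index t)) (u (D k) n)) (unindex-index t)
         (close (s≤s (index-bound t t≤K))))

  Cauchyᵂ : (ℕ → Config X) → Set
  Cauchyᵂ v = ∀ k → ∃ λ N → ∀ i j → N ≤ i → N ≤ j → W k (v i) (v j)

  cauchy⇒limitᵂ : ∀ {v} → Cauchyᵂ v → ∃ λ w → ∀ k → ∃ λ N → ∀ i → N ≤ i → W k w (v i)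
  cauchy⇒limitᵂ {v} cauchy = (λ t → proj₁ (limit t)) , λ k →
    let (N , close) = cauchy (suc k) in
    N , λ i N≤i → window λ t t≤k →
      let (M , lim) = proj₂ (limit t) (suc k) in
      -- The intermediate index may depend on the coordinate `t` through `M`, while `N` serves the
      -- whole window.
      E-trans (lim (M ℕ.+ N) (ℕ.m≤m+n M N))
        (at (close (M ℕ.+ N) i (ℕ.m≤n+m N M) N≤i) t (ℕ.m≤n⇒m≤1+n t≤k))
    where
    limit : ∀ t → ∃ (Limit (λ i → v i t))
    limit t = cauchy⇒limit λ k →
      let (N , close) = cauchy (k ℕ.+ ∣ t ∣) in
      N , λ i j N≤i N≤j → E-mono (ℕ.m≤m+n k ∣ t ∣) (at (close i j N≤i N≤j) t (ℕ.m≤n+m ∣ t ∣ k))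

  -- An approximate sliding block code: a finite window of `z` determines the entry of `v` at its
  -- centre up to `E k`. Equivalently, `S^ m z ↦ v m` is uniformly continuous on the orbit.
  UniformAlong : Config X → Config X → Set
  UniformAlong z v = ∀ k → ∃ λ K → ∀ m n → W K (S^ X m z) (S^ X n z) → E k (v m) (v n)

  module FactorMap (z z′ : Config X)
    (f : Subsystem.Point (OrbitSystem X z) → Subsystem.Point (OrbitSystem X z′))
    (f-cong : ∀ {u v} → (∀ t → proj₁ u t ≈ proj₁ v t) → ∀ t → proj₁ (f u) t ≈ proj₁ (f v) t)
    (f-continuous : Continuous X (OrbitSystem X z) (OrbitSystem X z′) f)
    (f-equivariant : ∀ u t → proj₁ (f (Subsystem.shift (OrbitSystem X z) u)) t ≈ proj₁ (f u) (t + 1ℤ))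
    where

    image : Config X
    image = proj₁ (f (orbitPoint z 0ℤ))

    image∈ : InOrbitClosure z′ image
    image∈ = closure⇒ {z′} {image} (proj₂ (f (orbitPoint z 0ℤ)))

    f-next : ∀ m t → proj₁ (f (orbitPoint z (m + 1ℤ))) t ≈ proj₁ (f (orbitPoint z m)) (t + 1ℤ)
    f-next m t = ≈-trans
      (f-cong {orbitPoint z (m + 1ℤ)} {Subsystem.shift (OrbitSystem X z) (orbitPoint z m)} (λ t → ≈-≡ (cong z (lemma t m))) t)
      (f-equivariant (orbitPoint z m) t)
      where
      ≈-≡ : ∀ {u v} → u ≡ v → u ≈ v
      ≈-≡ refl = ≈-refl
      lemma : ∀ t m → t + (m + 1ℤ) ≡ t + 1ℤ + m
      lemma = solve-∀

    f-orbit : ∀ m t → proj₁ (f (orbitPoint z m)) t ≈ image (t + m)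
    f-orbit (+ zero) t = subst (λ s → image t ≈ image s) (sym (ℤ.+-identityʳ t)) ≈-refl
    f-orbit (+ suc m) t = subst₂ (λ n s → proj₁ (f (orbitPoint z n)) t ≈ image s) (ℤ.+-comm (+ m) 1ℤ) (lemma t (+ m))
      (≈-trans (f-next (+ m) t) (f-orbit (+ m) (t + 1ℤ)))
      where
      lemma : ∀ t m → t + 1ℤ + m ≡ t + (1ℤ + m)
      lemma = solve-∀
    -- For negative times equivariance is used backwards, from time `m + 1` to time `m`.
    f-orbit -[1+ m ] t = subst₂ (λ s s′ → proj₁ (f (orbitPoint z -[1+ m ])) s ≈ image s′) (lemma₁ t) (lemma₂ t -[1+ m ])
      (≈-trans (≈-sym (f-next -[1+ m ] (t + -1ℤ))) (previous m (t + -1ℤ)))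
      where
      lemma₁ : ∀ t → t + -1ℤ + 1ℤ ≡ t
      lemma₁ = solve-∀
      lemma₂ : ∀ t m → t + -1ℤ + (m + 1ℤ) ≡ t + m
      lemma₂ = solve-∀
      previous : ∀ m t → proj₁ (f (orbitPoint z (-[1+ m ] + 1ℤ))) t ≈ image (t + (-[1+ m ] + 1ℤ))
      previous zero    = f-orbit (+ zero)
      previous (suc m) = f-orbit -[1+ m ]

    f-continuousᵂ : ∀ u k → ∃ λ K → ∀ v → W K (proj₁ u) (proj₁ v) → W k (proj₁ (f u)) (proj₁ (f v))
    f-continuousᵂ u k with f-continuous u (interval k) (const (ρ k)) (0<constρ k)
    ... | G , δ , 0<δ , cont with W⇒Near G δ 0<δ
    ... | K , near = K , λ v h → Near⇒W k (cont v (near h))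

    value : ∀ {k} u K → (∀ v → W K (proj₁ u) (proj₁ v) → W k (proj₁ (f u)) (proj₁ (f v))) →
      ∀ m → W K (proj₁ u) (S^ X m z) → E k (proj₁ (f u) 0ℤ) (image m)
    value {k} u K cont m h = subst (λ s → E k (proj₁ (f u) 0ℤ) (image s)) (ℤ.+-identityˡ m)
      (E-resp ≈-refl (f-orbit m 0ℤ) (at (cont (orbitPoint z m) h) 0ℤ z≤n))

    -- Continuity on a compact set is uniform: pairs of times that violate it for ever larger
    -- windows accumulate at a point `w` of the orbit closure, where `f` would fail to be
    -- continuous.
    uniform : UniformAlong z image
    uniform k = decidable-stable (decide₀ _) contradictory
      where
      contradictory : ¬ ¬ (∃ λ K → ∀ m n → W K (S^ X m z) (S^ X n z) → E k (image m) (image n))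
      contradictory ¬uniform = proj₂ (proj₂ (proj₂ (bad i)))
        (E-trans (E-sym (value (w , w∈) K cont m (W-mono (ℕ.n≤1+n K) near-m)))
                 (value (w , w∈) K cont n (W-trans near-m (W-mono K<i (proj₁ (proj₂ (proj₂ (bad i))))))))
        where
        bad : ∀ K → ∃₂ λ m n → W K (S^ X m z) (S^ X n z) × ¬ E k (image m) (image n)
        bad K = decidable-stable (decide₀ _) λ ¬bad → ¬uniform (K , λ m n h →
          decidable-stable (decide₀ _) λ ¬e → ¬bad (m , n , h , ¬e))
        clusters : ∃ λ w → ∀ K → ∃ λ i → K ≤ i × W K w (S^ X (proj₁ (bad i)) z)
        clusters = cluster-config (λ K → S^ X (proj₁ (bad K)) z)
        w : Config X
        w = proj₁ clusters
        w∈ : OrbitClosure X z w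
        w∈ = closure⇐ {z} {w} λ K → proj₁ (bad (proj₁ (proj₂ clusters K))) , proj₂ (proj₂ (proj₂ clusters K))
        K : ℕ
        K = proj₁ (f-continuousᵂ (w , w∈) (suc k))
        cont : ∀ v → W K w (proj₁ v) → W (suc k) (proj₁ (f (w , w∈))) (proj₁ (f v))
        cont = proj₂ (f-continuousᵂ (w , w∈) (suc k))
        i : ℕ
        i = proj₁ (proj₂ clusters (suc K))
        K<i : suc K ≤ i
        K<i = proj₁ (proj₂ (proj₂ clusters (suc K)))
        m n : ℤ
        m = proj₁ (bad i)
        n = proj₁ (proj₂ (bad i))
        near-m : W (suc K) w (S^ X m z)
        near-m = proj₂ (proj₂ (proj₂ clusters (suc K)))

-- Factor maps of Oxtoby systems

recentre : ∀ c t → ∣ t ∣ ≤ c → ∃ λ s → + c + t ≡ + s × s ≤ c ℕ.+ c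
recentre c (+ n)    n≤c = c ℕ.+ n , refl , ℕ.+-monoʳ-≤ c n≤c
recentre c -[1+ n ] n<c = c ℕ.∸ suc n , ℤ.⊖-≥ n<c , ℕ.≤-trans (ℕ.m∸n≤m c (suc n)) (ℕ.m≤m+n c c)

∣-∣-bound : ∀ {b e l} → b ≤ e ℕ.+ l → e ≤ b ℕ.+ l → ∣ + b - + e ∣ ≤ l
∣-∣-bound {b} {e} {l} b≤ e≤ rewrite ℤ.[+m]-[+n]≡m⊖n b e with ℕ.≤-total b e
... | inj₁ b≤e rewrite ℤ.∣⊖∣-≤ b≤e = ℕ.m≤n+o⇒m∸n≤o e b e≤
... | inj₂ e≤b rewrite ℤ.∣m⊖n∣≡∣n⊖m∣ b e | ℤ.∣⊖∣-≤ e≤b = ℕ.m≤n+o⇒m∸n≤o b e b≤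

module Dynamics {a ℓ} (em : ExcludedMiddle (a ⊔ ℓ)) (X : MetricSpace a ℓ) (compact : IsCompact X)
                {p : ℕ → ℕ} (fg : FastGrowing p) where
  open MetricSpace X
  open Compactness em X compact
  open FastGrowing fg
  open Levels fg

  Dominates : (x x′ : ℕ → Carrier) → Set
  Dominates x x′ = ∀ k → ∃ λ l → ∀ i j → l ≤ i → l ≤ j → E l (x i) (x j) → E k (x′ i) (x′ j)

  module _ {x x′ : ℕ → Carrier} {z z′ : Config X} (reads : Reads x z) (reads′ : Reads x′ z′) where

    module Rigidity (w : Config X) (w∈ : InOrbitClosure z′ w) (uniform : UniformAlong z w)
                    (k₁ : ℕ) (far : ∀ I → ∃₂ λ i j → I ≤ i × I ≤ j × ¬ E k₁ (x′ i) (x′ j)) where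
      -- Precision `k₁ + 2`, because `clash` joins three estimates by two triangle inequalities.
      l : ℕ
      l = proj₁ (uniform (suc (suc k₁)))

      -- The central gap of z is, up to l, a central gap of S^q z′.
      rigid : ∀ I → l ≤ first I → ∀ K → ∃₂ λ q c → W K w (S^ X q z′) × q ≡ c [mod-p suc I ] × ∣ c ∣ ≤ l
      rigid I l≤ K = q , + b - + e , W-mono (ℕ.m≤m+n K _) near , q≡c , ∣-∣-bound (proj₁ (proj₂ (proj₂ found))) (proj₂ (proj₂ (proj₂ found)))
        where
        i j : ℕ
        i = proj₁ (far (suc I))
        j = proj₁ (proj₂ (far (suc I)))
        I<i : suc I ≤ i
        I<i = proj₁ (proj₂ (proj₂ (far (suc I))))
        I<j : suc I ≤ j
        I<j = proj₁ (proj₂ (proj₂ (proj₂ (far (suc I)))))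
        ¬close : ¬ E k₁ (x′ i) (x′ j)
        ¬close = proj₂ (proj₂ (proj₂ (proj₂ (far (suc I)))))
        -- Windows of radius `l` centred in `[-b , b)` stay inside the central gap of `z`, whose
        -- half-width is `first (suc I)`.
        b : ℕ
        b = first (suc I) ℕ.∸ l
        a≡b+l : first (suc I) ≡ b ℕ.+ l
        a≡b+l = sym (ℕ.m∸n+n≡m (ℕ.≤-trans l≤ (ℕ.m≤m+n (first I) (p I))))
        p≤b : p I ≤ b
        p≤b = ℕ.+-cancelʳ-≤ l (p I) b (ℕ.≤-trans (ℕ.+-monoʳ-≤ (p I) l≤)
          (ℕ.≤-reflexive (trans (ℕ.+-comm (p I) (first I)) a≡b+l)))
        k₂ = suc (suc k₁)
        P = p (suc i) ℕ.+ p (suc j)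
        K′ = K ℕ.+ (k₂ ℕ.+ (b ℕ.+ P))
        q : ℤ
        q = proj₁ (w∈ K′)
        near : W K′ w (S^ X q z′)
        near = proj₂ (w∈ K′)
        offset : ℕ → ℤ
        offset u = - (+ b) + + u
        offset-bound : ∀ u → u < b ℕ.+ b → ∣ offset u ∣ ≤ b
        offset-bound u u<2b = subst (λ s → ∣ s ∣ ≤ b) (ℤ.+-comm (+ u) (- (+ b)))
          (∣-∣-bound {u} {b} {b} (ℕ.<⇒≤ u<2b) (ℕ.m≤n+m b u))
        module _ (u : ℕ) (u<2b : u < b ℕ.+ b) where
          value : ∀ i′ e → e < p (suc i′) → p (suc i′) ≤ P → HasLevel i′ (q - + b + + u + + e) →
            E k₂ (w (offset u + + e)) (x′ i′)
          value i′ e e<p p≤P lv = subst (E k₂ (w n)) (trans (cong z′ (lemma q (+ b) (+ u) (+ e))) (reads′ lv))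
            (E-mono (≤-+ K _ (inj₂ (ℕ.m≤m+n k₂ _))) (at near n n≤))
            where
            n = offset u + + e
            lemma : ∀ q b u e → - b + u + e + q ≡ q + - b + u + e
            lemma = solve-∀
            n≤ : ∣ n ∣ ≤ K′
            n≤ = begin
              ∣ offset u + + e ∣      ≤⟨ ℤ.∣i+j∣≤∣i∣+∣j∣ (offset u) (+ e) ⟩
              ∣ offset u ∣ ℕ.+ e      ≤⟨ ℕ.+-mono-≤ (offset-bound u u<2b) (ℕ.≤-trans (ℕ.<⇒≤ e<p) p≤P) ⟩
              b ℕ.+ P                 ≤⟨ ℕ.m≤n+m _ k₂ ⟩
              k₂ ℕ.+ (b ℕ.+ P)        ≤⟨ ℕ.m≤n+m _ K ⟩
              K′                      ∎
              where open ℕ.≤-Reasoning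

          constant : ∀ e → + e ≡ 0ℤ [mod-p suc I ] → ∀ t → ∣ t ∣ ≤ l →
            z (t + (offset u + + e)) ≡ z (t + offset u)
          constant e e≡0 t t≤l = reads-periodic reads
            (subst₂ (λ m n → m ≡ n [mod-p suc I ]) (lemma (+ e) t (offset u)) (ℤ.+-identityˡ (t + offset u)) (≡p-+ (t + offset u) e≡0))
            (λ h → central-gap (suc I) 0ℤ (u ℕ.+ s) in-gap (subst (Hole (suc I)) position h))
            where
            s : ℕ
            s = proj₁ (recentre l t t≤l)
            l+t≡s : + l + t ≡ + s
            l+t≡s = proj₁ (proj₂ (recentre l t t≤l))
            s≤2l : s ≤ l ℕ.+ l
            s≤2l = proj₂ (proj₂ (recentre l t t≤l))
            lemma : ∀ e t o → e + (t + o) ≡ t + (o + e)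
            lemma = solve-∀
            lemma₁ : ∀ t b u l P → t + (- b + u) ≡ 0ℤ * P + - (b + l) + (u + (l + t))
            lemma₁ = solve-∀
            position : t + offset u ≡ 0ℤ * + p (suc I) - + first (suc I) + + (u ℕ.+ s)
            position = trans (lemma₁ t (+ b) (+ u) (+ l) (+ p (suc I)))
              (cong₂ (λ c d → 0ℤ * + p (suc I) + - (+ c) + (+ u + d)) (sym a≡b+l) l+t≡s)
            in-gap : u ℕ.+ s < first (suc I) ℕ.+ first (suc I)
            in-gap = subst (u ℕ.+ s <_) (trans (lemma₂ b l) (cong₂ ℕ._+_ (sym a≡b+l) (sym a≡b+l)))
              (ℕ.+-mono-<-≤ u<2b s≤2l)
              where
              lemma₂ : ∀ b l → b ℕ.+ b ℕ.+ (l ℕ.+ l) ≡ b ℕ.+ l ℕ.+ (b ℕ.+ l)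
              lemma₂ = ℕSolver.solve-∀

          -- A hole would have translates by multiples of `p (suc I)` at which `z′` takes the values
          -- `x′ i` and `x′ j`. By `constant` the corresponding windows of `z` are equal, so `w`
          -- nearly agrees there, which contradicts `¬close`.
          ¬hole : ¬ Hole (suc I) (q - + b + + u)
          ¬hole h = clash (hole-spread (q - + b + + u) h I<i) (hole-spread (q - + b + + u) h I<j)
            where
            Spread : ℕ → Set
            Spread i = ∃ λ e → e < p (suc i) × HasLevel i (q - + b + + u + + e) × + e ≡ 0ℤ [mod-p suc I ]
            clash : Spread i → Spread j → ⊥
            clash (e , e<p , lv , e≡0) (e′ , e′<p , lv′ , e′≡0) = ¬close (E-trans (E-pred (E-sym (value i e e<p (ℕ.m≤m+n _ _) lv)))
              (E-trans (proj₂ (uniform k₂) (offset u + + e) (offset u + + e′) (window λ t t≤l →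
                  E-≡ (trans (constant e e≡0 t t≤l) (sym (constant e′ e′≡0 t t≤l)))))
                (value j e′ e′<p (ℕ.m≤n+m _ _) lv′)))

        found = gap-position I (q - + b) b l a≡b+l p≤b ¬hole
        e : ℕ
        e = proj₁ found
        q≡c : q ≡ + b - + e [mod-p suc I ]
        q≡c = subst₂ (λ m n → m ≡ n [mod-p suc I ]) (lemma q (+ b) (+ e)) (ℤ.+-identityˡ (+ b - + e))
          (≡p-+ (+ b - + e) (proj₁ (proj₂ found)))
          where
          lemma : ∀ q b e → q + - b + e + (b + - e) ≡ q
          lemma = solve-∀

      -- The values `x′ i` and `x′ j` appear in `w` near `first i - c` and `first j - c`. The
      -- windows of `z` around these two places agree off the `I`-holes, and at the `I`-holes they
      -- show `x i` and `x j`, which are close.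
      dominates : Dominates x x′
      dominates k = I , λ i j I≤i I≤j e → conclude i j I≤i I≤j e
        where
        l₂ : ℕ
        l₂ = proj₁ (uniform (suc (suc k)))
        I : ℕ
        -- `l` bounds the displacement `c` and `l₂` the radius of the windows; their sum is at most
        -- `first I`.
        I = l ℕ.+ l₂
        conclude : ∀ i j → I ≤ i → I ≤ j → E I (x i) (x j) → E k (x′ i) (x′ j)
        conclude i j I≤i I≤j close = E-trans (E-pred (E-sym (value i I≤i (s≤s (ℕ.m≤m+n i j)) (ℕ.m≤m+n (first i) (first j)))))
          (E-trans (proj₂ (uniform k₂) (+ first i - c) (+ first j - c) (window same-window))
            (value j I≤j (s≤s (ℕ.m≤n+m j i)) (ℕ.m≤n+m (first j) (first i))))
          where
          k₂ = suc (suc k)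
          I⁺ : ℕ
          -- Both `p (suc i)` and `p (suc j)` divide `p (suc I⁺)`, so `q ≡ c` preserves the levels
          -- `i` and `j`.
          I⁺ = i ℕ.+ j
          l≤I⁺ : l ≤ first I⁺
          l≤I⁺ = ℕ.≤-trans (ℕ.m≤m+n l l₂) (ℕ.≤-trans I≤i (ℕ.≤-trans (ℕ.m≤m+n i j) (I≤first I⁺)))
          K = first i ℕ.+ first j ℕ.+ l ℕ.+ k₂
          r = rigid I⁺ l≤I⁺ K
          q c : ℤ
          q = proj₁ r
          c = proj₁ (proj₂ r)
          near : W K w (S^ X q z′)
          near = proj₁ (proj₂ (proj₂ r))
          q≡c : q ≡ c [mod-p suc I⁺ ]
          q≡c = proj₁ (proj₂ (proj₂ (proj₂ r)))
          c≤l : ∣ c ∣ ≤ l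
          c≤l = proj₂ (proj₂ (proj₂ (proj₂ r)))
          value : ∀ m → I ≤ m → suc m ≤ suc I⁺ → first m ≤ first i ℕ.+ first j → E k₂ (w (+ first m - c)) (x′ m)
          value m I≤m m≤I⁺ first≤ = subst (E k₂ (w n)) (reads′ lv)
            (E-mono (ℕ.m≤n+m k₂ _) (at near n n≤K))
            where
            n = + first m - c
            lemma : ∀ f c → c + (f + - c) ≡ f
            lemma = solve-∀
            lv : HasLevel m (n + q)
            lv = Level-cong (≡p-sym (subst₂ (λ s t → s ≡ t [mod-p suc m ]) (ℤ.+-comm q n) (lemma (+ first m) c)
              (≡p-+ n (≡p-mono m≤I⁺ q≡c)))) (first-level m)
            n≤K : ∣ n ∣ ≤ K
            n≤K = begin
              ∣ + first m - c ∣                 ≤⟨ ℤ.∣i-j∣≤∣i∣+∣j∣ (+ first m) c ⟩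
              first m ℕ.+ ∣ c ∣                 ≤⟨ ℕ.+-mono-≤ first≤ c≤l ⟩
              first i ℕ.+ first j ℕ.+ l         ≤⟨ ℕ.m≤m+n _ k₂ ⟩
              K                                 ∎
              where open ℕ.≤-Reasoning
          same-window : ∀ t → ∣ t ∣ ≤ l₂ → E l₂ (z (t + (+ first i - c))) (z (t + (+ first j - c)))
          same-window t t≤ = compare (recentre (first I) (t - c) t-c≤) (first-mod I≤i) (first-mod I≤j)
            where
            t-c≤ : ∣ t - c ∣ ≤ first I
            t-c≤ = ℕ.≤-trans (ℤ.∣i-j∣≤∣i∣+∣j∣ t c) (ℕ.≤-trans (ℕ.+-mono-≤ t≤ c≤l)
              (ℕ.≤-trans (ℕ.≤-reflexive (ℕ.+-comm l₂ l)) (I≤first I)))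
            compare : (∃ λ s → + first I + (t - c) ≡ + s × s ≤ first I ℕ.+ first I) →
              + first i ≡ + first I [mod-p I ] → + first j ≡ + first I [mod-p I ] →
              E l₂ (z (t + (+ first i - c))) (z (t + (+ first j - c)))
            compare (s , a+t≡s , s≤2a) (congruent κ i≡) (congruent κ′ j≡) =
              subst₂ (λ m n → E l₂ (z m) (z n)) (sym (position i κ i≡)) (sym (position j κ′ j≡)) (cases (level-or-hole I (+ s + κ′ * + p I)))
              where
              s<p : s < p I
              s<p = ℕ.≤-<-trans s≤2a (2first<p I)
              lemma : ∀ t a c κ → t + (a + κ + - c) ≡ a + (t + - c) + κ
              lemma = solve-∀
              position : ∀ i κ → + first i ≡ + first I + κ * + p I → t + (+ first i - c) ≡ + s + κ * + p I
              position i κ eq = trans (cong (λ f → t + (f + - c)) eq)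
                (trans (lemma t (+ first I) c (κ * + p I)) (cong (_+ κ * + p I) a+t≡s))
              s≡ : ∀ κ κ′ → + s + κ * + p I ≡ + s + κ′ * + p I [mod-p I ]
              s≡ κ κ′ = ≡p-trans (congruent {n = + s} κ refl) (≡p-sym (congruent κ′ refl))
              same : ∀ i κ → I ≤ i → + first i ≡ + first I + κ * + p I → Hole I (+ s + κ * + p I) → z (+ s + κ * + p I) ≡ x i
              same i κ I≤i eq h = reads (Level-block {I} I≤i
                (trans (trans (cong (_/ℕ p I) eq) (/ℕ-unique (p I) (first I) κ (first<p I))) (sym (/ℕ-unique (p I) s κ s<p)))
                h (first-level i))
              cases : (∃ λ i → i < I × HasLevel i (+ s + κ′ * + p I)) ⊎ Hole I (+ s + κ′ * + p I) →
                E l₂ (z (+ s + κ * + p I)) (z (+ s + κ′ * + p I))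
              cases (inj₁ (i , i<I , lv)) = E-≡ (reads-periodic reads (s≡ κ κ′) λ h → ℕ.<⇒≱ i<I (hole-level h lv))
              cases (inj₂ h) = subst₂ (E l₂) (sym (same i κ I≤i i≡ (Hole-cong (s≡ κ′ κ) h))) (sym (same j κ′ I≤j j≡ h))
                (E-mono (ℕ.m≤n+m l₂ l) close)

-- Domination and topological types

module Transfer {a ℓ} (em : ExcludedMiddle (a ⊔ ℓ)) (X : MetricSpace a ℓ) (compact : IsCompact X)
                {p : ℕ → ℕ} (fg : FastGrowing p) where
  open MetricSpace X
  open Compactness em X compact
  open Dynamics em X compact fg
  open FastGrowing fg
  open Levels fg

  far-pairs : ∀ {y} → ¬ Cauchyᴱ y → ∃ λ k → ∀ I → ∃₂ λ i j → I ≤ i × I ≤ j × ¬ E k (y i) (y j)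
  far-pairs {y} ¬cauchy with ¬∀⇒∃¬ ¬cauchy
  ... | k , ¬close = k , λ I → decidable-stable (decide₀ _) λ ¬far → ¬close (I , λ i j I≤i I≤j →
    decidable-stable (decide₀ _) λ ¬e → ¬far (i , j , I≤i , I≤j , ¬e))

  uniform⇒dominates : ∀ {x x′ : ℕ → Carrier} {z z′ : Config X} → Reads x z → Reads x′ z′ →
    ∀ w → InOrbitClosure z′ w → UniformAlong z w → Dominates x x′
  uniform⇒dominates {x} {x′} reads reads′ w w∈ uniform with decide₀ (Cauchyᴱ x′)
  -- Every sequence dominates a Cauchy sequence.
  ... | yes cauchy = λ k → let (N , close) = cauchy k in N , λ i j N≤i N≤j _ → close i j N≤i N≤j
  ... | no ¬cauchy with far-pairs ¬cauchy
  ... | k , far = Rigidity.dominates reads reads′ w w∈ uniform k far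

  increasing-expands : ∀ (n : ℕ → ℕ) → (∀ {k l} → k < l → n k < n l) → ∀ k → k ≤ n k
  increasing-expands n inc zero    = z≤n
  increasing-expands n inc (suc k) = ℕ.≤-<-trans (increasing-expands n inc k) (inc (ℕ.n<1+n k))

  dominates⇒converges : ∀ {x x′} → Dominates x x′ → ∀ (n : ℕ → ℕ) → (∀ {k l} → k < l → n k < n l) →
    Converges X (x ∘ n) → Converges X (x′ ∘ n)
  dominates⇒converges {x} {x′} dom n inc conv = limit⇒converges (x′ ∘ n) (proj₂ (cauchy⇒limit cauchy′))
    where
    expands = increasing-expands n inc
    cauchy₀ : Cauchyᴱ (x ∘ n)
    cauchy₀ = converges⇒cauchy (x ∘ n) conv
    cauchy′ : Cauchyᴱ (x′ ∘ n)
    cauchy′ k = l ℕ.+ N , λ i j ≤i ≤j → proj₂ (dom k) (n i) (n j)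
      (ℕ.≤-trans (ℕ.m≤m+n l N) (ℕ.≤-trans ≤i (expands i)))
      (ℕ.≤-trans (ℕ.m≤m+n l N) (ℕ.≤-trans ≤j (expands j)))
      (proj₂ (cauchy₀ l) i j (ℕ.≤-trans (ℕ.m≤n+m N l) ≤i) (ℕ.≤-trans (ℕ.m≤n+m N l) ≤j))
      where
      l N : ℕ
      l = proj₁ (dom k)
      N = proj₁ (cauchy₀ l)

  -- A failure of domination gives pairs i < j, arbitrarily late, with x i and x j both near a
  -- point v but x′ i and x′ j apart; strung together, they form the sequence `merged`.
  module Interleaving (x x′ : ℕ → Carrier) (v : Carrier) (k : ℕ)
    (pair : ∀ K → ∃₂ λ i j → K ≤ i × i < j × E K v (x i) × E K v (x j) × ¬ E k (x′ i) (x′ j)) where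

    i j : ℕ → ℕ
    i K = proj₁ (pair K)
    j K = proj₁ (proj₂ (pair K))

    -- Exceeding `j K` keeps the merged sequence increasing; exceeding `K` makes its precision grow.
    next : ℕ → ℕ
    next K = suc (K ℕ.+ j K)

    merged : ℕ → ℕ → ℕ
    merged K zero          = i K
    merged K (suc zero)    = j K
    merged K (suc (suc t)) = merged (next K) t

    merged-step : ∀ K t → merged K t < merged K (suc t)
    merged-step K zero          = proj₁ (proj₂ (proj₂ (proj₂ (pair K))))
    merged-step K (suc zero)    = ℕ.<-≤-trans (s≤s (ℕ.m≤n+m (j K) K)) (proj₁ (proj₂ (proj₂ (pair (next K)))))
    merged-step K (suc (suc t)) = merged-step (next K) t

    merged-increasing : ∀ K {s t} → s < t → merged K s < merged K t
    merged-increasing K s<t = go (ℕ.≤⇒≤′ s<t)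
      where
      go : ∀ {s t} → suc s ℕ.≤′ t → merged K s < merged K t
      go {s} (ℕ.≤′-reflexive refl) = merged-step K s
      go {t = suc t} (ℕ.≤′-step le) = ℕ.<-trans (go le) (merged-step K t)

    K<next : ∀ K → suc K ≤ next K
    K<next K = s≤s (ℕ.m≤m+n K (j K))

    -- From term `2s` on, `s` pairs have been passed, each raising the precision by at least one.
    merged-close : ∀ s K t → s ℕ.+ s ≤ t → E (K ℕ.+ s) v (x (merged K t))
    merged-close zero K zero _ rewrite ℕ.+-identityʳ K = proj₁ (proj₂ (proj₂ (proj₂ (proj₂ (pair K)))))
    merged-close zero K (suc zero) _ rewrite ℕ.+-identityʳ K = proj₁ (proj₂ (proj₂ (proj₂ (proj₂ (proj₂ (pair K))))))
    merged-close zero K (suc (suc t)) _ = E-mono (ℕ.+-monoˡ-≤ 0 (ℕ.≤-trans (ℕ.n≤1+n K) (K<next K))) (merged-close zero (next K) t z≤n)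
    merged-close (suc s) K (suc zero) (s≤s le) = contradiction (ℕ.≤-trans (ℕ.m≤n+m (suc s) s) le) λ ()
    merged-close (suc s) K (suc (suc t)) (s≤s le) = E-mono
      (subst (_≤ next K ℕ.+ s) (sym (ℕ.+-suc K s)) (ℕ.+-monoˡ-≤ s (K<next K)))
      (merged-close s (next K) t (ℕ.≤-pred (subst (_≤ suc t) (ℕ.+-suc s s) le)))

    merged-far : ∀ N K → ∃ λ t → N ≤ t × ¬ E k (x′ (merged K t)) (x′ (merged K (suc t)))
    merged-far zero    K = zero , z≤n , proj₂ (proj₂ (proj₂ (proj₂ (proj₂ (proj₂ (pair K))))))
    merged-far (suc N) K with merged-far N (next K)
    ... | t , N≤t , far = suc (suc t) , s≤s (ℕ.m≤n⇒m≤1+n N≤t) , far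

    converges : Converges X (x ∘ merged 0)
    converges = limit⇒converges (x ∘ merged 0) {v} λ k → k ℕ.+ k , merged-close k 0

    diverges : ¬ Converges X (x′ ∘ merged 0)
    diverges conv = clash (converges⇒cauchy (x′ ∘ merged 0) conv k)
      where
      clash : (∃ λ N → ∀ s t → N ≤ s → N ≤ t → E k (x′ (merged 0 s)) (x′ (merged 0 t))) → ⊥
      clash (N , cauchy) with merged-far N 0
      ... | t , N≤t , far = far (cauchy t (suc t) N≤t (ℕ.m≤n⇒m≤1+n N≤t))

  -- If domination fails at `k`, there are bad pairs for every `l`. The first members of these pairs
  -- have a cluster point by compactness, and the second members are near it too, so interleaving
  -- gives a subsequence along which only `x` converges.
  converges⇒dominates : ∀ {x x′} →
    (∀ (n : ℕ → ℕ) → (∀ {k l} → k < l → n k < n l) → Converges X (x ∘ n) → Converges X (x′ ∘ n)) → Dominates x x′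
  converges⇒dominates {x} {x′} transfer k = decidable-stable (decide₀ _) contradictory
    where
    contradictory : ¬ ¬ (∃ λ l → ∀ i j → l ≤ i → l ≤ j → E l (x i) (x j) → E k (x′ i) (x′ j))
    contradictory ¬dom = diverges (transfer (merged 0) (merged-increasing 0) converges)
      where
      Bad : ℕ → ℕ → ℕ → Set
      Bad l i j = l ≤ i × E l (x i) (x j) × ¬ E k (x′ i) (x′ j)
      bad : ∀ l → ∃₂ λ i j → i < j × Bad l i j
      bad l = decidable-stable (decide₀ _) λ ¬bad → ¬dom (l , λ i j l≤i l≤j e →
        decidable-stable (decide₀ _) (order ¬bad i j l≤i l≤j e (ℕ.<-cmp i j)))
        where
        order : ¬ (∃₂ λ i j → i < j × Bad l i j) → ∀ i j → l ≤ i → l ≤ j → E l (x i) (x j) →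
          Tri (i < j) (i ≡ j) (j < i) → ¬ ¬ E k (x′ i) (x′ j)
        order ¬bad i j l≤i l≤j e (tri< i<j _ _) ¬e = ¬bad (i , j , i<j , l≤i , e , ¬e)
        order ¬bad i j l≤i l≤j e (tri≈ _ refl _) ¬e = ¬e (E-reflexive ≈-refl)
        order ¬bad i j l≤i l≤j e (tri> _ _ j<i) ¬e = ¬bad (j , i , j<i , l≤j , E-sym e , ¬e ∘ E-sym)
      i j : ℕ → ℕ
      i l = proj₁ (bad l)
      j l = proj₁ (proj₂ (bad l))
      v : Carrier
      v = proj₁ (cluster-point (x ∘ i))
      pair : ∀ K → ∃₂ λ i j → K ≤ i × i < j × E K v (x i) × E K v (x j) × ¬ E k (x′ i) (x′ j)
      pair K = choose (proj₂ (cluster-point (x ∘ i)) (suc K) (suc K))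
        where
        choose : (∃ λ l → suc K ≤ l × E (suc K) v (x (i l))) → ∃₂ λ i j → K ≤ i × i < j × E K v (x i) × E K v (x j) × ¬ E k (x′ i) (x′ j)
        choose (l , K<l , e) = collect (proj₂ (proj₂ (bad l)))
          where
          collect : i l < j l × Bad l (i l) (j l) → ∃₂ λ i j → K ≤ i × i < j × E K v (x i) × E K v (x j) × ¬ E k (x′ i) (x′ j)
          collect (i<j , l≤i , e′ , ¬e) = i l , j l , ℕ.≤-trans (ℕ.<⇒≤ K<l) l≤i , i<j , E-pred e , E-trans e (E-mono K<l e′) , ¬e
      open Interleaving x x′ v k pair

  -- Recovering residues from windows

  module Recognizability {x : ℕ → Carrier} {z : Config X} (reads : Reads x z) (aperiodic : NonPeriodic X z) where

    -- If `x` were constant from `I` on, all `I`-holes would carry the same value and `z` would have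
    -- period `p I`.
    distinct-tail : ∀ I → ∃₂ λ i k → I ≤ i × ¬ E k (x I) (x i)
    distinct-tail I = decidable-stable (decide₀ _) λ constant →
      aperiodic (+ p I) (λ p≡0 → ℕ.<⇒≢ (ℕ.≤-trans (s≤s z≤n) (i<pᵢ I)) (sym (ℤ.+-injective p≡0))) λ t →
      let tail : ∀ i → I ≤ i → x I ≈ x i
          tail i I≤i = E-separates λ k → decidable-stable (decide₀ _) λ ¬e → constant (i , k , I≤i , ¬e)
      in periodic tail t (level-or-hole I t)
      where
      shift≡ : ∀ t → t + + p I ≡ t [mod-p I ]
      shift≡ t = congruent 1ℤ (cong (_+_ t) (sym (ℤ.*-identityˡ (+ p I))))
      at-hole : (∀ i → I ≤ i → x I ≈ x i) → ∀ n → Hole I n → x I ≈ z n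
      at-hole tail n h with level n
      ... | i , lv = subst (x I ≈_) (sym (reads lv)) (tail i (hole-level h lv))
      periodic : (∀ i → I ≤ i → x I ≈ x i) → ∀ t → (∃ λ i → i < I × HasLevel i t) ⊎ Hole I t → z (t + + p I) ≈ z t
      periodic tail t (inj₁ (i , i<I , lv)) = subst (z (t + + p I) ≈_)
        (reads-periodic reads (shift≡ t) λ h → ℕ.<⇒≱ i<I (hole-level h lv)) ≈-refl
      periodic tail t (inj₂ h) = ≈-trans (≈-sym (at-hole tail _ (Hole-cong (≡p-sym (shift≡ t)) h))) (at-hole tail t h)

    -- The central gap next to `n` is matched, in the window of `m`, by an interval without holes: a
    -- hole there would show two distinct values at translates by multiples of `P`, where the window
    -- of `n` shows a single one. As the interval is as long as the central gap, its centre is a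
    -- multiple of `P`.
    recognize : ∀ I → ∃ λ K → ∀ m n → W K (S^ X m z) (S^ X n z) → m ≡ n [mod-p suc I ]
    recognize I = K , conclude
      where
      P f : ℕ
      P = p (suc I)
      f = first (suc I)
      i k : ℕ
      i = proj₁ (distinct-tail (suc I))
      k = proj₁ (proj₂ (distinct-tail (suc I)))
      I<i : suc I ≤ i
      I<i = proj₁ (proj₂ (proj₂ (distinct-tail (suc I))))
      ¬close : ¬ E k (x (suc I)) (x i)
      ¬close = proj₂ (proj₂ (proj₂ (distinct-tail (suc I))))
      Q K : ℕ
      Q = p (suc (suc I)) ℕ.+ p (suc i)
      K = suc k ℕ.+ (P ℕ.+ f ℕ.+ (f ℕ.+ f ℕ.+ Q))
      conclude : ∀ m n → W K (S^ X m z) (S^ X n z) → m ≡ n [mod-p suc I ]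
      -- No tolerance is lost here, so `gap-position` with `l = 0` locates the centre exactly.
      conclude m n near = finish (gap-position I (m - + s - + f) f 0 (sym (ℕ.+-identityʳ f)) (ℕ.m≤n+m (p I) (first I)) ¬hole)
        where
        s : ℕ
        s = n %ℕ P
        κ : ℤ
        κ = n /ℕ P
        n≡ : n ≡ + s + κ * + P
        n≡ = ℤ.a≡a%ℕn+[a/ℕn]*n n P
        module _ (u : ℕ) (u<2a : u < f ℕ.+ f) where
          gap : ℤ
          gap = κ * + P - + f + + u
          value : ∀ j e → e < p (suc j) → p (suc j) ≤ Q → HasLevel j (m - + s - + f + + u + + e) → + e ≡ 0ℤ [mod-p suc I ] →
            E (suc k) (x j) (z gap)
          value j e e<p p≤Q lv e≡0 = subst₂ (E (suc k))
            (trans (cong z (lemma₁ m (+ s) (+ f) (+ u) (+ e))) (reads lv))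
            (reads-periodic reads same (central-gap (suc I) κ u u<2a))
            (E-mono (ℕ.m≤m+n (suc k) _) (at near τ τ≤K))
            where
            τ = - (+ s) + - (+ f) + + u + + e
            lemma₁ : ∀ m s f u e → - s + - f + u + e + m ≡ m + - s + - f + u + e
            lemma₁ = solve-∀
            lemma₂ : ∀ s f u e κ → e + (κ + - f + u) ≡ - s + - f + u + e + (s + κ)
            lemma₂ = solve-∀
            same : τ + n ≡ gap [mod-p suc I ]
            same = subst₂ (λ b c → b ≡ c [mod-p suc I ])
              (trans (lemma₂ (+ s) (+ f) (+ u) (+ e) (κ * + P)) (cong (_+_ τ) (sym n≡)))
              (ℤ.+-identityˡ gap) (≡p-+ gap e≡0)
            τ≤K : ∣ τ ∣ ≤ K
            τ≤K = begin
              ∣ τ ∣                                        ≤⟨ ℤ.∣i+j∣≤∣i∣+∣j∣ (- (+ s) + - (+ f) + + u) (+ e) ⟩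
              ∣ - (+ s) + - (+ f) + + u ∣ ℕ.+ e            ≤⟨ ℕ.+-monoˡ-≤ e (ℤ.∣i+j∣≤∣i∣+∣j∣ (- (+ s) + - (+ f)) (+ u)) ⟩
              ∣ - (+ s) + - (+ f) ∣ ℕ.+ u ℕ.+ e            ≤⟨ ℕ.+-monoˡ-≤ e (ℕ.+-monoˡ-≤ u (ℤ.∣i+j∣≤∣i∣+∣j∣ (- (+ s)) (- (+ f)))) ⟩
              ∣ - (+ s) ∣ ℕ.+ ∣ - (+ f) ∣ ℕ.+ u ℕ.+ e      ≡⟨ cong₂ (λ b c → b ℕ.+ c ℕ.+ u ℕ.+ e) (ℤ.∣-i∣≡∣i∣ (+ s)) (ℤ.∣-i∣≡∣i∣ (+ f)) ⟩
              s ℕ.+ f ℕ.+ u ℕ.+ e                          ≡⟨ ℕ.+-assoc (s ℕ.+ f) u e ⟩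
              s ℕ.+ f ℕ.+ (u ℕ.+ e)                        ≤⟨ ℕ.+-mono-≤ (ℕ.+-monoˡ-≤ f (ℕ.<⇒≤ (ℤ.n%ℕd<d n P)))
                                                               (ℕ.+-mono-≤ (ℕ.<⇒≤ u<2a) (ℕ.≤-trans (ℕ.<⇒≤ e<p) p≤Q)) ⟩
              P ℕ.+ f ℕ.+ (f ℕ.+ f ℕ.+ Q)                  ≤⟨ ℕ.m≤n+m _ (suc k) ⟩
              K                                            ∎
              where open ℕ.≤-Reasoning

          Spread : ℕ → Set
          Spread j = ∃ λ e → e < p (suc j) × HasLevel j (m - + s - + f + + u + + e) × + e ≡ 0ℤ [mod-p suc I ]

          clash : Spread (suc I) → Spread i → ⊥
          clash (e , e<p , lv , e≡0) (e′ , e′<p , lv′ , e′≡0) = ¬close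
            (E-trans (value (suc I) e e<p (ℕ.m≤m+n _ _) lv e≡0) (E-sym (value i e′ e′<p (ℕ.m≤n+m _ _) lv′ e′≡0)))

          ¬hole : ¬ Hole (suc I) (m - + s - + f + + u)
          ¬hole h = clash (hole-spread (m - + s - + f + + u) h ℕ.≤-refl) (hole-spread (m - + s - + f + + u) h I<i)

        finish : (∃ λ e → (m - + s - + f + + e ≡ 0ℤ [mod-p suc I ]) × f ≤ e ℕ.+ 0 × e ≤ f ℕ.+ 0) → m ≡ n [mod-p suc I ]
        finish (e , e≡0 , a≤e , e≤a) = ≡p-trans
          (subst₂ (λ b c → b ≡ c [mod-p suc I ]) (trans (cong (λ e → m - + s - + f + + e + + s) e≡a) (lemma m (+ s) (+ f)))
            (ℤ.+-identityˡ (+ s)) (≡p-+ (+ s) e≡0))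
          (≡p-sym (congruent κ n≡))
          where
          e≡a : e ≡ f
          e≡a = ℕ.≤-antisym (subst (e ≤_) (ℕ.+-identityʳ f) e≤a) (subst (f ≤_) (ℕ.+-identityʳ e) a≤e)
          lemma : ∀ m s f → m + - s + - f + f + s ≡ m
          lemma = solve-∀

    -- Recognition makes `m` and `n` congruent modulo `p (suc l)`. Off the holes `z′` then agrees
    -- exactly; at holes both levels exceed `l` and domination applies.
    dominates⇒uniform : ∀ {x′ z′} → Reads x′ z′ → Dominates x x′ → UniformAlong z z′
    dominates⇒uniform {x′} {z′} reads′ dom k = l ℕ.+ proj₁ (recognize l) , λ m n near →
      compare m n (at near 0ℤ z≤n) (proj₂ (recognize l) m n (W-mono (ℕ.m≤n+m _ l) near)) (level-or-hole (suc l) n)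
      where
      l : ℕ
      l = proj₁ (dom k)
      compare : ∀ m n → E (l ℕ.+ proj₁ (recognize l)) (z (0ℤ + m)) (z (0ℤ + n)) → m ≡ n [mod-p suc l ] →
        (∃ λ i → i < suc l × HasLevel i n) ⊎ Hole (suc l) n → E k (z′ m) (z′ n)
      compare m n e m≡n (inj₁ (i , i<l , lv)) = E-≡ (reads-periodic reads′ m≡n λ h → ℕ.<⇒≱ i<l (hole-level h lv))
      compare m n e m≡n (inj₂ h) = values (level m) (level n)
        where
        values : (∃ λ i → HasLevel i m) → (∃ λ j → HasLevel j n) → E k (z′ m) (z′ n)
        values (i , lv) (j , lv′) = subst₂ (E k) (sym (reads′ lv)) (sym (reads′ lv′))
          (proj₂ (dom k) i j (ℕ.≤-trans (ℕ.n≤1+n l) (hole-level (Hole-cong (≡p-sym m≡n) h) lv))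
            (ℕ.≤-trans (ℕ.n≤1+n l) (hole-level h lv′))
            (subst₂ (E l) (trans (cong z (ℤ.+-identityˡ m)) (reads lv)) (trans (cong z (ℤ.+-identityˡ n)) (reads lv′))
              (E-mono (ℕ.m≤m+n l _) e)))

-- Extension of uniformly continuous maps to orbit closures

module Conjugacy {a ℓ} (em : ExcludedMiddle (a ⊔ ℓ)) (X : MetricSpace a ℓ) (compact : IsCompact X) where
  open MetricSpace X
  open Compactness em X compact

  uniform-window : ∀ {z v} → UniformAlong z v →
    ∀ k → ∃ λ K → ∀ m n → W K (S^ X m z) (S^ X n z) → W k (S^ X m v) (S^ X n v)
  uniform-window {z} {v} uniform k = K ℕ.+ k , λ m n near → window λ t t≤k →
    proj₂ (uniform k) (t + m) (t + n) (window λ s s≤K →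
      subst₂ (λ i j → E K (z i) (z j)) (ℤ.+-assoc s t m) (ℤ.+-assoc s t n)
        (E-mono (ℕ.m≤m+n K k) (at near (s + t)
          (ℕ.≤-trans (ℤ.∣i+j∣≤∣i∣+∣j∣ s t) (ℕ.+-mono-≤ s≤K t≤k)))))
    where
    K : ℕ
    K = proj₁ (uniform k)

  module Extension {z v : Config X} (uniform : UniformAlong z v) where

    modulus : ℕ → ℕ
    modulus k = proj₁ (uniform-window {z} {v} uniform k)

    modulus-works : ∀ k m n → W (modulus k) (S^ X m z) (S^ X n z) → W k (S^ X m v) (S^ X n v)
    modulus-works k = proj₂ (uniform-window {z} {v} uniform k)

    module _ {w : Config X} (w∈ : InOrbitClosure z w) where

      times : ℕ → ℤ
      times k = proj₁ (w∈ k)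

      limit : ∃ λ w′ → ∀ k → ∃ λ N → ∀ i → N ≤ i → W k w′ (S^ X (times i) v)
      limit = cauchy⇒limitᵂ λ k → suc (modulus k) , λ i j ≤i ≤j → modulus-works k (times i) (times j)
        (W-trans (W-sym (W-mono ≤i (proj₂ (w∈ i)))) (W-mono ≤j (proj₂ (w∈ j))))

      extend : Config X
      extend = proj₁ limit

      -- Frees the extension from the chosen `times`: any orbit point near `w` approximates it
      -- equally well.
      extend-near : ∀ k n → W (suc (modulus (suc k))) w (S^ X n z) → W k extend (S^ X n v)
      extend-near k n near = W-trans (proj₂ (proj₂ limit (suc k)) i (ℕ.m≤m+n N K))
        (modulus-works (suc k) (times i) n (W-trans (W-sym (W-mono (ℕ.m≤n+m K N) (proj₂ (w∈ i)))) near))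
        where
        N K i : ℕ
        N = proj₁ (proj₂ limit (suc k))
        K = suc (modulus (suc k))
        i = N ℕ.+ K

      extend∈ : InOrbitClosure v extend
      extend∈ k = times K , extend-near k (times K) (proj₂ (w∈ K))
        where
        K : ℕ
        K = suc (modulus (suc k))

    map : Subsystem.Point (OrbitSystem X z) → Subsystem.Point (OrbitSystem X v)
    map (w , w∈) = extend (closure⇒ {z} {w} w∈) , closure⇐ {v} (extend∈ (closure⇒ {z} {w} w∈))

    map-near : ∀ k u n → W (suc (modulus (suc k))) (proj₁ u) (S^ X n z) → W k (proj₁ (map u)) (S^ X n v)
    map-near k (w , w∈) = extend-near (closure⇒ {z} {w} w∈) k

    map-continuousᵂ : ∀ k u u′ → W (suc (suc (modulus (suc (suc k))))) (proj₁ u) (proj₁ u′) → W k (proj₁ (map u)) (proj₁ (map u′))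
    map-continuousᵂ k u u′ near = W-trans
      (map-near (suc k) u n (W-trans near near′))
      (W-sym (map-near (suc k) u′ n (W-mono (ℕ.n≤1+n _) near′)))
      where
      approx : ∃ λ n → W (suc (suc (modulus (suc (suc k))))) (proj₁ u′) (S^ X n z)
      approx = closure⇒ {z} {proj₁ u′} (proj₂ u′) (suc (suc (modulus (suc (suc k)))))
      n : ℤ
      n = proj₁ approx
      near′ : W (suc (suc (modulus (suc (suc k))))) (proj₁ u′) (S^ X n z)
      near′ = proj₂ approx

    map-continuous : Continuous X (OrbitSystem X z) (OrbitSystem X v) map
    map-continuous u F ε 0<ε = interval K , const (ρ K) , 0<constρ K , λ u′ near →
      proj₂ (W⇒Near F ε 0<ε) (map-continuousᵂ k u u′ (Near⇒W K near))
      where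
      k K : ℕ
      k = proj₁ (W⇒Near F ε 0<ε)
      K = suc (suc (modulus (suc (suc k))))

    map-cong : ∀ {u u′} → (∀ t → proj₁ u t ≈ proj₁ u′ t) → ∀ t → proj₁ (map u) t ≈ proj₁ (map u′) t
    map-cong {u} {u′} u≈u′ = W-separates λ k → map-continuousᵂ k u u′ (window λ t _ → E-reflexive (u≈u′ t))

    map-equivariant : ∀ u t → proj₁ (map (Subsystem.shift (OrbitSystem X z) u)) t ≈ proj₁ (map u) (t + 1ℤ)
    map-equivariant u = W-separates λ k → close k
      where
      w : Config X
      w = proj₁ u
      shift-near : ∀ {k} {w : Config X} y n → W (suc k) w (S^ X n y) → W k (S X w) (S^ X (n + 1ℤ) y)
      shift-near {k} {w} y n near = window λ t t≤k →
        subst (λ s → E k (w (t + 1ℤ)) (y s)) (lemma t n)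
          (E-pred (at near (t + 1ℤ) (ℕ.≤-trans (ℤ.∣i+j∣≤∣i∣+∣j∣ t 1ℤ)
            (ℕ.≤-trans (ℕ.+-monoˡ-≤ 1 t≤k) (ℕ.≤-reflexive (ℕ.+-comm k 1))))))
        where
        lemma : ∀ t n → t + 1ℤ + n ≡ t + (n + 1ℤ)
        lemma = solve-∀
      close : ∀ k → W k (proj₁ (map (Subsystem.shift (OrbitSystem X z) u))) (S X (proj₁ (map u)))
      -- One orbit point near `u` serves for both sides, since its shift is near the shift of `u`.
      close k = W-trans
        (map-near (suc k) (Subsystem.shift (OrbitSystem X z) u) (n + 1ℤ) (shift-near z n (W-mono (ℕ.m≤m+n (suc K₁) (suc K₂)) near)))
        (W-sym (shift-near v n (map-near (suc (suc k)) u n (W-mono (ℕ.≤-trans (ℕ.n≤1+n K₂) (ℕ.m≤n+m (suc K₂) (suc K₁))) near))))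
        where
        K₁ K₂ : ℕ
        K₁ = suc (modulus (suc (suc k)))
        K₂ = suc (modulus (suc (suc (suc k))))
        approx : ∃ λ n → W (suc K₁ ℕ.+ suc K₂) w (S^ X n z)
        approx = closure⇒ {z} {w} (proj₂ u) (suc K₁ ℕ.+ suc K₂)
        n : ℤ
        n = proj₁ approx
        near : W (suc K₁ ℕ.+ suc K₂) w (S^ X n z)
        near = proj₂ approx

  module _ {z v : Config X} (forth : UniformAlong z v) (back : UniformAlong v z) where
    private
      module F = Extension {z} {v} forth
      module G = Extension {v} {z} back

    -- On orbit points the two maps undo each other; an arbitrary point is approximated by one of
    -- them, with the precision chosen backwards through both moduli.
    round-trip : ∀ u t → proj₁ (G.map (F.map u)) t ≈ proj₁ u t
    round-trip u = W-separates close
      where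
      close : ∀ k → W k (proj₁ (G.map (F.map u))) (proj₁ u)
      close k = W-trans (G.map-near (suc k) (F.map u) n
          (F.map-near K₂ u n (W-mono (ℕ.m≤m+n K₁ (suc k)) near)))
        (W-sym (W-mono (ℕ.m≤n+m (suc k) K₁) near))
        where
        K₁ K₂ : ℕ
        K₂ = suc (G.modulus (suc (suc k)))
        K₁ = suc (F.modulus (suc K₂))
        approx : ∃ λ n → W (K₁ ℕ.+ suc k) (proj₁ u) (S^ X n z)
        approx = closure⇒ {z} {proj₁ u} (proj₂ u) (K₁ ℕ.+ suc k)
        n : ℤ
        n = proj₁ approx
        near : W (K₁ ℕ.+ suc k) (proj₁ u) (S^ X n z)
        near = proj₂ approx

  conjugate : ∀ {z v} → UniformAlong z v → UniformAlong v z → Conjugate X (OrbitSystem X z) (OrbitSystem X v)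
  conjugate {z} {v} forth back = record
    { bijection = record
      { to        = F.map
      ; from      = G.map
      ; to-cong   = λ {u} {u′} → F.map-cong {u} {u′}
      ; from-cong = λ {u} {u′} → G.map-cong {u} {u′}
      ; inverse   =
          (λ {u} {u′} u′≈ t → ≈-trans (F.map-cong {u′} {G.map u} u′≈ t) (round-trip {v} {z} back forth u t)) ,
          (λ {u} {u′} u′≈ t → ≈-trans (G.map-cong {u′} {F.map u} u′≈ t) (round-trip {z} {v} forth back u t))
      }
    ; to-continuous   = F.map-continuous
    ; from-continuous = G.map-continuous
    ; equivariant     = F.map-equivariant
    }
    where
    module F = Extension {z} {v} forth
    module G = Extension {v} {z} back

  module _ {z v : Config X} (conj : Conjugate X (OrbitSystem X z) (OrbitSystem X v)) where
    open Conjugate conj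
    open Inverse bijection using (to; from; to-cong; from-cong; inverseˡ; inverseʳ)

    -- Obtained by applying `from` to the equivariance of `to` at `from u`, so that the inverse is a
    -- factor map as well.
    from-equivariant : ∀ u t →
      proj₁ (from (Subsystem.shift (OrbitSystem X v) u)) t ≈ proj₁ (from u) (t + 1ℤ)
    from-equivariant u = inverseʳ {Subsystem.shift (OrbitSystem X z) (from u)} {Subsystem.shift (OrbitSystem X v) u}
      λ t → ≈-sym (≈-trans (equivariant (from u) t) (inverseˡ {u} {from u} (λ _ → ≈-refl) (t + 1ℤ)))

    module To   = FactorMap z v to (λ {u} {u′} → to-cong {u} {u′}) to-continuous equivariant
    module From = FactorMap v z from (λ {u} {u′} → from-cong {u} {u′}) from-continuous from-equivariant

-- Conjugacy and topological type

theorem7p1 : ∀ {a ℓ} → ExcludedMiddle (a ⊔ ℓ) →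
    (X : MetricSpace a ℓ) → IsCompact X →
    (x x′ : ℕ → MetricSpace.Carrier X) →
    (p : ℕ → ℕ) (fg : FastGrowing p) →
    NonPeriodic X (Oxtoby.z fg x) →
    NonPeriodic X (Oxtoby.z fg x′) →
    Conjugate X (OrbitSystem X (Oxtoby.z fg x)) (OrbitSystem X (Oxtoby.z fg x′))
    ⇔ SameTopologicalType X x x′
theorem7p1 em X compact x x′ p fg aperiodic aperiodic′ = mk⇔ sameType conjugacy
  where
  open Compactness em X compact
  open Transfer em X compact fg
  open Levels fg
  open Conjugacy em X compact
  z z′ : Config X
  z = Oxtoby.z fg x
  z′ = Oxtoby.z fg x′

  sameType : Conjugate X (OrbitSystem X z) (OrbitSystem X z′) → SameTopologicalType X x x′
  sameType conj n inc = mk⇔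
    (dominates⇒converges (uniform⇒dominates {z = z} {z′} (z-level x) (z-level x′) (To.image conj) (To.image∈ conj) (To.uniform conj)) n inc)
    (dominates⇒converges (uniform⇒dominates {z = z′} {z} (z-level x′) (z-level x) (From.image conj) (From.image∈ conj) (From.uniform conj)) n inc)

  conjugacy : SameTopologicalType X x x′ → Conjugate X (OrbitSystem X z) (OrbitSystem X z′)
  conjugacy same = conjugate {z} {z′}
    (Recognizability.dominates⇒uniform {z = z} (z-level x) aperiodic {z′ = z′} (z-level x′)
      (converges⇒dominates λ n inc → Equivalence.to (same n inc)))
    (Recognizability.dominates⇒uniform {z = z′} (z-level x′) aperiodic′ {z′ = z} (z-level x)
      (converges⇒dominates λ n inc → Equivalence.from (same n inc)))
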